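{- Let $0<q<1$, let $k$ be a nonnegative integer, $n$ a positive integer, and $x\in[0,1]$. Then $$\left(\frac{n-k}{n}\right)B_{k,n}(x,q)+\left(\frac{k+1}{n}\right)B_{k+1,n}(x,q)=B_{k,n-1}(x,q)+(1-q)[x]_q[1-x]_q\,B_{k,n-1}(x,q).$$
   Context: Let $q$ be a real number with $0<q<1$. For real $x$, the $q$-number is $[x]_q=\frac{1-q^x}{1-q}$. For a nonnegative integer $k$ and $x\in[0,1]$, the modified $q$-Bernstein polynomials $B_{k,n}(x,q)$, $n=0,1,2,\dots$, are defined by the generating function $$\frac{t^k e^{[1-x]_q t}[x]_q^k}{k!}=\sum_{n=0}^\infty B_{k,n}(x,q)\frac{t^n}{n!}.$$ -}

module Defs where

open import Algebra.Bundles using (RawSemiring)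
import Algebra.Definitions.RawSemiring as RawSemiringDefs
open import Data.Integer.Base using (+_; 1ℤ)
import Data.Integer.Base as ℤ
import Data.Integer.Properties as ℤₚ
open import Data.Nat.Base using (ℕ; zero; suc; _!; _∸_)
import Data.Nat.Base as ℕ
import Data.Nat.Properties as ℕₚ
open import Data.Product.Base using (∃; _×_; _,_; proj₁; proj₂)
open import Data.Rational.Base using (ℚ; 0ℚ; 1ℚ; ½; ∣_∣)
import Data.Rational.Base as ℚ
import Data.Rational.Properties as ℚₚ
import Data.Rational.Unnormalised.Base as ℚᵘ
import Data.Rational.Unnormalised.Properties as ℚᵘₚ
open import Data.Rational.Solver using (module +-*-Solver)
open import Data.Sum.Base using (_⊎_; inj₁; inj₂)
open import Level using (0ℓ)
open import Relation.Binary.PropositionalEquality using (_≡_; refl; sym; trans; cong; cong₂; subst)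

IsCauchy : (ℕ → ℚ) → Set
IsCauchy s = ∀ ε → 0ℚ ℚ.< ε → ∃ λ N → ∀ m n → N ℕ.≤ m → N ℕ.≤ n → ∣ s m ℚ.- s n ∣ ℚ.≤ ε

open RawSemiringDefs ℚ.+-*-rawSemiring using () renaming (_^_ to _^ℚ_)

fromℕ : ℕ → ℚ
fromℕ n = + n ℚ./ 1

1/! : ℕ → ℚ
1/! n = (1ℤ ℚ./ (n !)) {{ n ℕₚ.!≢0 }}

partialSum : (ℕ → ℚ) → ℕ → ℚ → ℚ
partialSum c zero    z = 0ℚ
partialSum c (suc n) z = partialSum c n z ℚ.+ c n ℚ.* (z ^ℚ n)

module Estimates where

  open import Data.Rational.Base using (_+_; _*_; _-_; -_; _≤_; _<_)
  open +-*-Solver using (solve; _:+_; _:*_; _:-_; :-_; _:=_; con)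
  open ℚₚ.≤-Reasoning

  *-monoˡ : ∀ {r p q} → 0ℚ ≤ r → p ≤ q → r * p ≤ r * q
  *-monoˡ {r} 0≤r = ℚₚ.*-monoˡ-≤-nonNeg r {{ ℚ.nonNegative 0≤r }}

  *-monoʳ : ∀ {r p q} → 0ℚ ≤ r → p ≤ q → p * r ≤ q * r
  *-monoʳ {r} 0≤r = ℚₚ.*-monoʳ-≤-nonNeg r {{ ℚ.nonNegative 0≤r }}

  *-mono : ∀ {p q r s} → 0ℚ ≤ q → 0ℚ ≤ r → p ≤ q → r ≤ s → p * r ≤ q * s
  *-mono 0≤q 0≤r p≤q r≤s = ℚₚ.≤-trans (*-monoʳ 0≤r p≤q) (*-monoˡ 0≤q r≤s)

  *-nonNeg : ∀ {p q} → 0ℚ ≤ p → 0ℚ ≤ q → 0ℚ ≤ p * q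
  *-nonNeg {p} {q} 0≤p 0≤q = subst (_≤ p * q) (ℚₚ.*-zeroʳ p) (*-monoˡ 0≤p 0≤q)

  *-pos : ∀ {p q} → 0ℚ < p → 0ℚ < q → 0ℚ < p * q
  *-pos {p} {q} 0<p 0<q =
    subst (_< p * q) (ℚₚ.*-zeroʳ p) (ℚₚ.*-monoʳ-<-pos p {{ ℚ.positive 0<p }} 0<q)

  +-nonNeg : ∀ {p q} → 0ℚ ≤ p → 0ℚ ≤ q → 0ℚ ≤ p + q
  +-nonNeg 0≤p 0≤q = ℚₚ.+-mono-≤ 0≤p 0≤q

  p≤p+q : ∀ {p q} → 0ℚ ≤ q → p ≤ p + q
  p≤p+q {p} {q} 0≤q = subst (_≤ p + q) (ℚₚ.+-identityʳ p) (ℚₚ.+-monoʳ-≤ p 0≤q)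

  p≤q+p : ∀ {p q} → 0ℚ ≤ q → p ≤ q + p
  p≤q+p {p} {q} 0≤q = subst (_≤ q + p) (ℚₚ.+-identityˡ p) (ℚₚ.+-monoˡ-≤ p 0≤q)

  0≤1 : 0ℚ ≤ 1ℚ
  0≤1 = ℚₚ.nonNegative⁻¹ 1ℚ

  0<1 : 0ℚ < 1ℚ
  0<1 = ℚₚ.positive⁻¹ 1ℚ

  p<q⇒0<q-p : ∀ {p q} → p < q → 0ℚ < q - p
  p<q⇒0<q-p {p} {q} p<q = subst (_< q - p) (ℚₚ.+-inverseʳ p) (ℚₚ.+-monoˡ-< (- p) p<q)

  p+r≤q⇒r≤q-p : ∀ {p q r} → p + r ≤ q → r ≤ q - p
  p+r≤q⇒r≤q-p {p} {q} {r} le =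
    subst (_≤ q - p) (solve 2 (λ p r → (p :+ r) :- p := r) refl p r) (ℚₚ.+-monoˡ-≤ (- p) le)

  inv : ∀ p → 0ℚ < p → ℚ
  inv p 0<p = (ℚ.1/ p) {{ ℚ.>-nonZero 0<p }}

  inv-pos : ∀ p (0<p : 0ℚ < p) → 0ℚ < inv p 0<p
  inv-pos p 0<p = ℚₚ.positive⁻¹ (inv p 0<p) {{ ℚₚ.1/pos⇒pos p {{ ℚ.positive 0<p }} }}

  inv-inverseʳ : ∀ p (0<p : 0ℚ < p) → p * inv p 0<p ≡ 1ℚ
  inv-inverseʳ p 0<p = ℚₚ.*-inverseʳ p {{ ℚ.>-nonZero 0<p }}

  inv-inverseˡ : ∀ p (0<p : 0ℚ < p) → inv p 0<p * p ≡ 1ℚ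
  inv-inverseˡ p 0<p = ℚₚ.*-inverseˡ p {{ ℚ.>-nonZero 0<p }}

  cancelˡ : ∀ {r p q} → 0ℚ < r → r * p ≤ r * q → p ≤ q
  cancelˡ {r} 0<r = ℚₚ.*-cancelˡ-≤-pos r {{ ℚ.positive 0<r }}

  inv-antimono : ∀ p q (0<p : 0ℚ < p) (0<q : 0ℚ < q) → p ≤ q → inv q 0<q ≤ inv p 0<p
  inv-antimono p q 0<p 0<q p≤q = cancelˡ 0<q (begin
    q * inv q 0<q  ≡⟨ inv-inverseʳ q 0<q ⟩
    1ℚ             ≡⟨ inv-inverseʳ p 0<p ⟨
    p * inv p 0<p  ≤⟨ *-monoʳ (ℚₚ.<⇒≤ (inv-pos p 0<p)) p≤q ⟩
    q * inv p 0<p  ∎)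

  -- It suffices to bound the oscillation by a fixed multiple of ε.
  scaled-isCauchy : ∀ s C → 0ℚ ≤ C →
    (∀ ε → 0ℚ < ε → ∃ λ N → ∀ m n → N ℕ.≤ m → N ℕ.≤ n → ∣ s m - s n ∣ ≤ C * ε) → IsCauchy s
  scaled-isCauchy s C 0≤C H ε 0<ε =
    let 0<C+1 : 0ℚ < C + 1ℚ
        0<C+1 = ℚₚ.+-mono-≤-< 0≤C 0<1
        i     = inv (C + 1ℚ) 0<C+1
        0<i   = inv-pos (C + 1ℚ) 0<C+1
        0<εi  = *-pos 0<ε 0<i
        N , h = H (ε * i) 0<εi
    in N , λ m n N≤m N≤n → begin
      ∣ s m - s n ∣           ≤⟨ h m n N≤m N≤n ⟩
      C * (ε * i)             ≤⟨ *-monoʳ {ε * i} {C} (ℚₚ.<⇒≤ 0<εi) (p≤p+q 0≤1) ⟩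
      (C + 1ℚ) * (ε * i)      ≡⟨ solve 3 (λ a b c → a :* (b :* c) := b :* (a :* c)) refl (C + 1ℚ) ε i ⟩
      ε * ((C + 1ℚ) * i)      ≡⟨ cong (ε *_) (inv-inverseʳ (C + 1ℚ) 0<C+1) ⟩
      ε * 1ℚ                  ≡⟨ ℚₚ.*-identityʳ ε ⟩
      ε                       ∎

  prefixBound : (s : ℕ → ℚ) (N : ℕ) → ∃ λ M → 0ℚ ≤ M × (∀ n → n ℕ.≤ N → ∣ s n ∣ ≤ M)
  prefixBound s zero    = ∣ s 0 ∣ , ℚₚ.0≤∣p∣ (s 0) , λ { zero ℕ.z≤n → ℚₚ.≤-refl }
  prefixBound s (suc N) =
    let M , 0≤M , h = prefixBound s N
        0≤a = ℚₚ.0≤∣p∣ (s (suc N))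
    in M + ∣ s (suc N) ∣ , +-nonNeg 0≤M 0≤a , λ n n≤1+N → bound M h 0≤M 0≤a n (ℕₚ.m≤n⇒m<n∨m≡n n≤1+N)
    where
    bound : ∀ M → (∀ n → n ℕ.≤ N → ∣ s n ∣ ≤ M) → 0ℚ ≤ M → 0ℚ ≤ ∣ s (suc N) ∣ →
            ∀ n → n ℕ.< suc N ⊎ n ≡ suc N → ∣ s n ∣ ≤ M + ∣ s (suc N) ∣
    bound M h 0≤M 0≤a n (inj₁ n<1+N) = ℚₚ.≤-trans (h n (ℕ.s≤s⁻¹ n<1+N)) (p≤p+q 0≤a)
    bound M h 0≤M 0≤a n (inj₂ refl)  = p≤q+p 0≤M

  ∣p∣≤∣p-q∣+∣q∣ : ∀ p q → ∣ p ∣ ≤ ∣ p - q ∣ + ∣ q ∣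
  ∣p∣≤∣p-q∣+∣q∣ p q = subst (λ r → ∣ r ∣ ≤ ∣ p - q ∣ + ∣ q ∣)
    (solve 2 (λ p q → (p :- q) :+ q := p) refl p q) (ℚₚ.∣p+q∣≤∣p∣+∣q∣ (p - q) q)

  cauchy-bounded : ∀ s → IsCauchy s → ∃ λ M → 0ℚ ≤ M × (∀ n → ∣ s n ∣ ≤ M)
  cauchy-bounded s cs =
    let N , h        = cs 1ℚ 0<1
        M , 0≤M , hM = prefixBound s N
    in 1ℚ + M , +-nonNeg 0≤1 0≤M , λ n → bound N h M hM n (ℕₚ.≤-total n N)
    where
    bound : ∀ N → (∀ m n → N ℕ.≤ m → N ℕ.≤ n → ∣ s m - s n ∣ ≤ 1ℚ) →
            ∀ M → (∀ n → n ℕ.≤ N → ∣ s n ∣ ≤ M) → ∀ n → n ℕ.≤ N ⊎ N ℕ.≤ n → ∣ s n ∣ ≤ 1ℚ + M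
    bound N h M hM n (inj₁ n≤N) = ℚₚ.≤-trans (hM n n≤N) (p≤q+p 0≤1)
    bound N h M hM n (inj₂ N≤n) = ℚₚ.≤-trans (∣p∣≤∣p-q∣+∣q∣ (s n) (s N))
      (ℚₚ.+-mono-≤ (h n N N≤n ℕₚ.≤-refl) (hM N ℕₚ.≤-refl))

  ∣p-q∣≡∣q-p∣ : ∀ p q → ∣ p - q ∣ ≡ ∣ q - p ∣
  ∣p-q∣≡∣q-p∣ p q = trans (cong ∣_∣ (solve 2 (λ p q → p :- q := :- (q :- p)) refl p q)) (ℚₚ.∣-p∣≡∣p∣ (q - p))

  const-isCauchy : ∀ p → IsCauchy (λ _ → p)
  const-isCauchy p ε 0<ε = 0 , λ _ _ _ _ →
    subst (λ r → ∣ r ∣ ≤ ε) (sym (ℚₚ.+-inverseʳ p)) (ℚₚ.<⇒≤ 0<ε)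

  +-isCauchy : ∀ s t → IsCauchy s → IsCauchy t → IsCauchy (λ n → s n + t n)
  +-isCauchy s t cs ct = scaled-isCauchy (λ n → s n + t n) (1ℚ + 1ℚ) (+-nonNeg 0≤1 0≤1) λ ε 0<ε →
    let N , h = cs ε 0<ε
        K , g = ct ε 0<ε
    in N ℕ.⊔ K , λ m n N≤m N≤n → begin
      ∣ (s m + t m) - (s n + t n) ∣    ≡⟨ cong ∣_∣ (solve 4 (λ a b c d → (a :+ b) :- (c :+ d) := (a :- c) :+ (b :- d)) refl (s m) (t m) (s n) (t n)) ⟩
      ∣ (s m - s n) + (t m - t n) ∣    ≤⟨ ℚₚ.∣p+q∣≤∣p∣+∣q∣ (s m - s n) (t m - t n) ⟩
      ∣ s m - s n ∣ + ∣ t m - t n ∣    ≤⟨ ℚₚ.+-mono-≤ (h m n (ℕₚ.m⊔n≤o⇒m≤o N K N≤m) (ℕₚ.m⊔n≤o⇒m≤o N K N≤n)) (g m n (ℕₚ.m⊔n≤o⇒n≤o N K N≤m) (ℕₚ.m⊔n≤o⇒n≤o N K N≤n)) ⟩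
      ε + ε                            ≡⟨ solve 1 (λ e → e :+ e := (con 1ℚ :+ con 1ℚ) :* e) refl ε ⟩
      (1ℚ + 1ℚ) * ε                    ∎

  neg-isCauchy : ∀ s → IsCauchy s → IsCauchy (λ n → - s n)
  neg-isCauchy s cs ε 0<ε =
    let N , h = cs ε 0<ε
    in N , λ m n N≤m N≤n → subst (_≤ ε)
      (trans (sym (ℚₚ.∣-p∣≡∣p∣ (s m - s n))) (cong ∣_∣ (ℚₚ.neg-distrib-+ (s m) (- s n))))
      (h m n N≤m N≤n)

  *-isCauchy : ∀ s t → IsCauchy s → IsCauchy t → IsCauchy (λ n → s n * t n)
  *-isCauchy s t cs ct =
    let A , 0≤A , hA = cauchy-bounded s cs
        B , 0≤B , hB = cauchy-bounded t ct
    in scaled-isCauchy (λ n → s n * t n) (A + B) (+-nonNeg 0≤A 0≤B) λ ε 0<ε →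
      let N , h = cs ε 0<ε
          K , g = ct ε 0<ε
      in N ℕ.⊔ K , λ m n N≤m N≤n → begin
        ∣ s m * t m - s n * t n ∣
          ≡⟨ cong ∣_∣ (solve 4 (λ a b c d → a :* b :- c :* d := a :* (b :- d) :+ d :* (a :- c)) refl (s m) (t m) (s n) (t n)) ⟩
        ∣ s m * (t m - t n) + t n * (s m - s n) ∣
          ≤⟨ ℚₚ.∣p+q∣≤∣p∣+∣q∣ (s m * (t m - t n)) (t n * (s m - s n)) ⟩
        ∣ s m * (t m - t n) ∣ + ∣ t n * (s m - s n) ∣
          ≡⟨ cong₂ _+_ (ℚₚ.∣p*q∣≡∣p∣*∣q∣ (s m) (t m - t n)) (ℚₚ.∣p*q∣≡∣p∣*∣q∣ (t n) (s m - s n)) ⟩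
        ∣ s m ∣ * ∣ t m - t n ∣ + ∣ t n ∣ * ∣ s m - s n ∣
          ≤⟨ ℚₚ.+-mono-≤
               (*-mono 0≤A (ℚₚ.0≤∣p∣ (t m - t n)) (hA m) (g m n (ℕₚ.m⊔n≤o⇒n≤o N K N≤m) (ℕₚ.m⊔n≤o⇒n≤o N K N≤n)))
               (*-mono 0≤B (ℚₚ.0≤∣p∣ (s m - s n)) (hB n) (h m n (ℕₚ.m⊔n≤o⇒m≤o N K N≤m) (ℕₚ.m⊔n≤o⇒m≤o N K N≤n))) ⟩
        A * ε + B * ε
          ≡⟨ ℚₚ.*-distribʳ-+ ε A B ⟨
        (A + B) * ε ∎

  δ⊔p>0 : ∀ {δ} → 0ℚ < δ → ∀ p → 0ℚ < δ ℚ.⊔ p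
  δ⊔p>0 {δ} 0<δ p = ℚₚ.<-≤-trans 0<δ (ℚₚ.p≤p⊔q δ p)

  inv-isCauchy : ∀ s {δ N} (0<δ : 0ℚ < δ) → (∀ n → N ℕ.≤ n → δ ≤ s n) → IsCauchy s →
                 IsCauchy (λ n → inv (δ ℚ.⊔ s n) (δ⊔p>0 0<δ (s n)))
  inv-isCauchy s {δ} {N} 0<δ δ≤s cs = scaled-isCauchy (λ n → inv (δ ℚ.⊔ s n) (δ⊔p>0 0<δ (s n))) (d * d) (*-nonNeg 0≤d 0≤d) λ ε 0<ε →
    let K , h = cs ε 0<ε
    in N ℕ.⊔ K , λ m n N≤m N≤n →
      let a   = δ ℚ.⊔ s m
          0<a = δ⊔p>0 0<δ (s m)
          b   = δ ℚ.⊔ s n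
          0<b = δ⊔p>0 0<δ (s n)
          i   = inv a 0<a
          j   = inv b 0<b
          a≡  : a ≡ s m
          a≡  = ℚₚ.p≤q⇒p⊔q≡q (δ≤s m (ℕₚ.m⊔n≤o⇒m≤o N K N≤m))
          b≡  : b ≡ s n
          b≡  = ℚₚ.p≤q⇒p⊔q≡q (δ≤s n (ℕₚ.m⊔n≤o⇒m≤o N K N≤n))
          0≤ij = *-nonNeg (ℚₚ.<⇒≤ (inv-pos a 0<a)) (ℚₚ.<⇒≤ (inv-pos b 0<b))
      in begin
        ∣ i - j ∣                ≡⟨ cong ∣_∣ (diff a i b j (inv-inverseʳ a 0<a) (inv-inverseʳ b 0<b)) ⟩
        ∣ (i * j) * (b - a) ∣    ≡⟨ ℚₚ.∣p*q∣≡∣p∣*∣q∣ (i * j) (b - a) ⟩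
        ∣ i * j ∣ * ∣ b - a ∣    ≡⟨ cong₂ _*_ (ℚₚ.0≤p⇒∣p∣≡p 0≤ij) (cong ∣_∣ (cong₂ _-_ b≡ a≡)) ⟩
        (i * j) * ∣ s n - s m ∣  ≤⟨ *-mono (*-nonNeg 0≤d 0≤d) (ℚₚ.0≤∣p∣ (s n - s m))
                                      (*-mono 0≤d (ℚₚ.<⇒≤ (inv-pos b 0<b))
                                         (inv-antimono δ a 0<δ 0<a (ℚₚ.p≤p⊔q δ (s m)))
                                         (inv-antimono δ b 0<δ 0<b (ℚₚ.p≤p⊔q δ (s n))))
                                      (h n m (ℕₚ.m⊔n≤o⇒n≤o N K N≤n) (ℕₚ.m⊔n≤o⇒n≤o N K N≤m)) ⟩
        (d * d) * ε              ∎
    where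
    d : ℚ
    d = inv δ 0<δ

    0≤d : 0ℚ ≤ d
    0≤d = ℚₚ.<⇒≤ (inv-pos δ 0<δ)

    diff : ∀ a i b j → a * i ≡ 1ℚ → b * j ≡ 1ℚ → i - j ≡ (i * j) * (b - a)
    diff a i b j ai bj = begin-equality
      i - j                          ≡⟨ cong₂ _-_ (ℚₚ.*-identityʳ i) (ℚₚ.*-identityʳ j) ⟨
      i * 1ℚ - j * 1ℚ                ≡⟨ cong₂ (λ u v → i * u - j * v) bj ai ⟨
      i * (b * j) - j * (a * i)      ≡⟨ solve 4 (λ a i b j → i :* (b :* j) :- j :* (a :* i) := (i :* j) :* (b :- a)) refl a i b j ⟩
      (i * j) * (b - a)              ∎

  toℚᵘ-/ : ∀ i n → ℚ.toℚᵘ (i ℚ./ suc n) ℚᵘ.≃ ℚᵘ.mkℚᵘ i n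
  toℚᵘ-/ i n = ℚₚ.toℚᵘ-fromℚᵘ (ℚᵘ.mkℚᵘ i n)

  fromℕ-+ : ∀ m n → fromℕ (m ℕ.+ n) ≡ fromℕ m + fromℕ n
  fromℕ-+ m n = ℚₚ.toℚᵘ-injective (ℚᵘₚ.≃-trans (toℚᵘ-/ (+ (m ℕ.+ n)) 0) (ℚᵘₚ.≃-sym
    (ℚᵘₚ.≃-trans (ℚₚ.toℚᵘ-homo-+ (fromℕ m) (fromℕ n))
    (ℚᵘₚ.≃-trans (ℚᵘₚ.+-cong (toℚᵘ-/ (+ m) 0) (toℚᵘ-/ (+ n) 0))
    (ℚᵘ.*≡* (cong (ℤ._* + 1) (cong₂ ℤ._+_ (ℤₚ.*-identityʳ (+ m)) (ℤₚ.*-identityʳ (+ n)))))))))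

  fromℕ-* : ∀ m n → fromℕ (m ℕ.* n) ≡ fromℕ m * fromℕ n
  fromℕ-* m n = ℚₚ.toℚᵘ-injective (ℚᵘₚ.≃-trans (toℚᵘ-/ (+ (m ℕ.* n)) 0) (ℚᵘₚ.≃-sym
    (ℚᵘₚ.≃-trans (ℚₚ.toℚᵘ-homo-* (fromℕ m) (fromℕ n))
    (ℚᵘₚ.≃-trans (ℚᵘₚ.*-cong (toℚᵘ-/ (+ m) 0) (toℚᵘ-/ (+ n) 0))
    (ℚᵘ.*≡* (cong (ℤ._* + 1) (sym (ℤₚ.pos-* m n))))))))

  fromℕ-suc : ∀ n → fromℕ (suc n) ≡ 1ℚ + fromℕ n
  fromℕ-suc n = fromℕ-+ 1 n

  fromℕ-nonNeg : ∀ n → 0ℚ ≤ fromℕ n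
  fromℕ-nonNeg n = ℚₚ.nonNegative⁻¹ (fromℕ n) {{ ℚₚ.normalize-nonNeg n 1 }}

  fromℕ-suc-pos : ∀ n → 0ℚ < fromℕ (suc n)
  fromℕ-suc-pos n = ℚₚ.positive⁻¹ (fromℕ (suc n)) {{ ℚₚ.normalize-pos (suc n) 1 }}

  fromℕ-mono : ∀ {m n} → m ℕ.≤ n → fromℕ m ≤ fromℕ n
  fromℕ-mono {m} {n} m≤n = subst (λ k → fromℕ m ≤ fromℕ k) (ℕₚ.m+[n∸m]≡n m≤n)
    (subst (fromℕ m ≤_) (sym (fromℕ-+ m (n ∸ m))) (p≤p+q (fromℕ-nonNeg (n ∸ m))))

  archimedean : ∀ p → ∃ λ n → p ≤ fromℕ n
  archimedean p@(ℚ.mkℚ i d _) = ℤ.∣ i ∣ , ℚₚ.toℚᵘ-cancel-≤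
    (ℚᵘₚ.≤-respʳ-≃ (ℚᵘₚ.≃-sym (toℚᵘ-/ (+ ℤ.∣ i ∣) 0)) (ℚᵘ.*≤* (i*1≤∣i∣*d i)))
    where
    i*1≤∣i∣*d : ∀ i → i ℤ.* + 1 ℤ.≤ + ℤ.∣ i ∣ ℤ.* + suc d
    i*1≤∣i∣*d (+ n)          = subst (ℤ._≤ + n ℤ.* + suc d) (ℤₚ.pos-* n 1)
      (subst (+ (n ℕ.* 1) ℤ.≤_) (ℤₚ.pos-* n (suc d)) (ℤ.+≤+ (ℕₚ.*-monoʳ-≤ n (ℕ.s≤s ℕ.z≤n))))
    i*1≤∣i∣*d (ℤ.-[1+ n ])   = ℤ.-≤+

  n*1/n≡1 : ∀ n .{{_ : ℕ.NonZero n}} → fromℕ n * (1ℤ ℚ./ n) ≡ 1ℚ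
  n*1/n≡1 (suc n) = ℚₚ.toℚᵘ-injective
    (ℚᵘₚ.≃-trans (ℚₚ.toℚᵘ-homo-* (fromℕ (suc n)) (1ℤ ℚ./ suc n))
    (ℚᵘₚ.≃-trans (ℚᵘₚ.*-cong (toℚᵘ-/ (+ suc n) 0) (toℚᵘ-/ 1ℤ n))
    (ℚᵘ.*≡* (trans (ℤₚ.*-identityʳ (+ suc n ℤ.* 1ℤ)) (trans (ℤₚ.*-comm (+ suc n) 1ℤ)
      (cong (λ k → 1ℤ ℤ.* + suc k) (sym (ℕₚ.+-identityʳ n))))))))

  1/n-pos : ∀ n .{{_ : ℕ.NonZero n}} → 0ℚ < 1ℤ ℚ./ n
  1/n-pos n = ℚₚ.positive⁻¹ (1ℤ ℚ./ n) {{ ℚₚ.normalize-pos 1 n }}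

  1/1+n≤1 : ∀ n → 1ℤ ℚ./ suc n ≤ 1ℚ
  1/1+n≤1 n = begin
    1ℤ ℚ./ suc n                    ≡⟨ ℚₚ.*-identityˡ (1ℤ ℚ./ suc n) ⟨
    1ℚ * (1ℤ ℚ./ suc n)             ≤⟨ *-monoʳ (ℚₚ.<⇒≤ (1/n-pos (suc n))) (fromℕ-mono {1} {suc n} (ℕ.s≤s ℕ.z≤n)) ⟩
    fromℕ (suc n) * (1ℤ ℚ./ suc n)  ≡⟨ n*1/n≡1 (suc n) ⟩
    1ℚ                              ∎

  n!*1/!n≡1 : ∀ n → fromℕ (n !) * 1/! n ≡ 1ℚ
  n!*1/!n≡1 n = n*1/n≡1 (n !) {{ n ℕₚ.!≢0 }}

  1/!-pos : ∀ n → 0ℚ < 1/! n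
  1/!-pos n = 1/n-pos (n !) {{ n ℕₚ.!≢0 }}

  1/!-suc : ∀ n → fromℕ (suc n) * 1/! (suc n) ≡ 1/! n
  1/!-suc n = begin-equality
    s * c'                    ≡⟨ ℚₚ.*-identityˡ (s * c') ⟨
    1ℚ * (s * c')             ≡⟨ cong (_* (s * c')) (n!*1/!n≡1 n) ⟨
    (f * c) * (s * c')        ≡⟨ solve 4 (λ f c s d → (f :* c) :* (s :* d) := c :* ((s :* f) :* d)) refl f c s c' ⟩
    c * ((s * f) * c')        ≡⟨ cong (λ a → c * (a * c')) (fromℕ-* (suc n) (n !)) ⟨
    c * (fromℕ (suc n !) * c') ≡⟨ cong (c *_) (n!*1/!n≡1 (suc n)) ⟩
    c * 1ℚ                    ≡⟨ ℚₚ.*-identityʳ c ⟩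
    c                         ∎
    where
    s f c c' : ℚ
    s  = fromℕ (suc n)
    f  = fromℕ (n !)
    c  = 1/! n
    c' = 1/! (suc n)

  ^-nonNeg : ∀ {p} → 0ℚ ≤ p → ∀ n → 0ℚ ≤ p ^ℚ n
  ^-nonNeg 0≤p zero    = 0≤1
  ^-nonNeg 0≤p (suc n) = *-nonNeg 0≤p (^-nonNeg 0≤p n)

  ∣^∣≤ : ∀ {p M} → ∣ p ∣ ≤ M → ∀ n → ∣ p ^ℚ n ∣ ≤ M ^ℚ n
  ∣^∣≤ {p} {M} h zero    = ℚₚ.≤-refl
  ∣^∣≤ {p} {M} h (suc n) = subst (_≤ M * M ^ℚ n) (sym (ℚₚ.∣p*q∣≡∣p∣*∣q∣ p (p ^ℚ n)))
    (*-mono (ℚₚ.≤-trans (ℚₚ.0≤∣p∣ p) h) (ℚₚ.0≤∣p∣ (p ^ℚ n)) h (∣^∣≤ h n))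

  r*p≤q⇒p≤r⁻¹*q : ∀ {r p q} (0<r : 0ℚ < r) → r * p ≤ q → p ≤ inv r 0<r * q
  r*p≤q⇒p≤r⁻¹*q {r} {p} {q} 0<r h = begin
    p                     ≡⟨ ℚₚ.*-identityˡ p ⟨
    1ℚ * p                ≡⟨ cong (_* p) (inv-inverseˡ r 0<r) ⟨
    (inv r 0<r * r) * p   ≡⟨ ℚₚ.*-assoc (inv r 0<r) r p ⟩
    inv r 0<r * (r * p)   ≤⟨ *-monoˡ (ℚₚ.<⇒≤ (inv-pos r 0<r)) h ⟩
    inv r 0<r * q         ∎

  module Geometric (θ : ℚ) (0≤θ : 0ℚ ≤ θ) (θ<1 : θ < 1ℚ) where

    u : ℚ
    u = 1ℚ - θ

    0<u : 0ℚ < u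
    0<u = p<q⇒0<q-p θ<1

    0≤u : 0ℚ ≤ u
    0≤u = ℚₚ.<⇒≤ 0<u

    S : ℕ → ℚ
    S n = partialSum fromℕ n θ

    S-nonNeg : ∀ n → 0ℚ ≤ S n
    S-nonNeg zero    = ℚₚ.≤-refl
    S-nonNeg (suc n) = +-nonNeg (S-nonNeg n) (*-nonNeg (fromℕ-nonNeg n) (^-nonNeg 0≤θ n))

    S-closed : ∀ n → (u * u) * S n + ((u * fromℕ n) * θ ^ℚ n + θ * θ ^ℚ n) ≡ θ
    S-closed zero    = solve 1 (λ θ → ((con 1ℚ :- θ) :* (con 1ℚ :- θ)) :* con 0ℚ :+ (((con 1ℚ :- θ) :* con 0ℚ) :* con 1ℚ :+ θ :* con 1ℚ) := θ) refl θ
    S-closed (suc n) = trans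
      (trans (cong (λ a → (u * u) * (S n + fromℕ n * θ ^ℚ n) + ((u * a) * (θ * θ ^ℚ n) + θ * (θ * θ ^ℚ n))) (fromℕ-suc n))
        (solve 4 (λ θ s k p →
           ((con 1ℚ :- θ) :* (con 1ℚ :- θ)) :* (s :+ k :* p) :+ (((con 1ℚ :- θ) :* (con 1ℚ :+ k)) :* (θ :* p) :+ θ :* (θ :* p))
           := ((con 1ℚ :- θ) :* (con 1ℚ :- θ)) :* s :+ (((con 1ℚ :- θ) :* k) :* p :+ θ :* p)) refl θ (S n) (fromℕ n) (θ ^ℚ n)))
      (S-closed n)

    0≤uu*S : ∀ n → 0ℚ ≤ (u * u) * S n
    0≤uu*S n = *-nonNeg (*-nonNeg 0≤u 0≤u) (S-nonNeg n)

    0≤unθⁿ : ∀ n → 0ℚ ≤ (u * fromℕ n) * θ ^ℚ n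
    0≤unθⁿ n = *-nonNeg (*-nonNeg 0≤u (fromℕ-nonNeg n)) (^-nonNeg 0≤θ n)

    0≤θθⁿ : ∀ n → 0ℚ ≤ θ * θ ^ℚ n
    0≤θθⁿ n = *-nonNeg 0≤θ (^-nonNeg 0≤θ n)

    uu*S≤1 : ∀ n → (u * u) * S n ≤ 1ℚ
    uu*S≤1 n = begin
      (u * u) * S n                                               ≤⟨ p≤p+q (+-nonNeg (0≤unθⁿ n) (0≤θθⁿ n)) ⟩
      (u * u) * S n + ((u * fromℕ n) * θ ^ℚ n + θ * θ ^ℚ n)       ≡⟨ S-closed n ⟩
      θ                                                           ≤⟨ ℚₚ.<⇒≤ θ<1 ⟩
      1ℚ                                                          ∎

    unθⁿ≤1 : ∀ n → (u * fromℕ n) * θ ^ℚ n ≤ 1ℚ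
    unθⁿ≤1 n = begin
      (u * fromℕ n) * θ ^ℚ n                                      ≤⟨ p≤p+q (0≤θθⁿ n) ⟩
      (u * fromℕ n) * θ ^ℚ n + θ * θ ^ℚ n                         ≤⟨ p≤q+p (0≤uu*S n) ⟩
      (u * u) * S n + ((u * fromℕ n) * θ ^ℚ n + θ * θ ^ℚ n)       ≡⟨ S-closed n ⟩
      θ                                                           ≤⟨ ℚₚ.<⇒≤ θ<1 ⟩
      1ℚ                                                          ∎

    vanishes : ∀ ε → 0ℚ < ε → ∃ λ N → ∀ n → N ℕ.≤ n → θ ^ℚ n ≤ ε
    vanishes ε 0<ε = suc (proj₁ arch) , small
      where
      0<uε : 0ℚ < u * ε
      0<uε = *-pos 0<u 0<ε

      arch : ∃ λ n → inv (u * ε) 0<uε ≤ fromℕ n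
      arch = archimedean (inv (u * ε) 0<uε)

      small : ∀ n → suc (proj₁ arch) ℕ.≤ n → θ ^ℚ n ≤ ε
      small (suc n) (ℕ.s≤s N≤n) = cancelˡ (*-pos 0<u (fromℕ-suc-pos n)) (begin
        (u * fromℕ (suc n)) * θ ^ℚ suc n  ≤⟨ unθⁿ≤1 (suc n) ⟩
        1ℚ                                ≡⟨ inv-inverseʳ (u * ε) 0<uε ⟨
        (u * ε) * inv (u * ε) 0<uε        ≤⟨ *-monoˡ (ℚₚ.<⇒≤ 0<uε) (ℚₚ.≤-trans (proj₂ arch) (fromℕ-mono (ℕₚ.m≤n⇒m≤1+n N≤n))) ⟩
        (u * ε) * fromℕ (suc n)           ≡⟨ solve 3 (λ a b c → (a :* b) :* c := (a :* c) :* b) refl u ε (fromℕ (suc n)) ⟩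
        (u * fromℕ (suc n)) * ε           ∎)

    module Series (c : ℕ → ℚ) (M B : ℚ) (0<M : 0ℚ < M) (0≤B : 0ℚ ≤ B)
                  (hc : ∀ m → ∣ c m ∣ * M ^ℚ m ≤ B * θ ^ℚ m) where

      P : ℕ → ℚ → ℚ
      P = partialSum c

      0≤M : 0ℚ ≤ M
      0≤M = ℚₚ.<⇒≤ 0<M

      term≤ : ∀ a → ∣ a ∣ ≤ M → ∀ m → ∣ c m * a ^ℚ m ∣ ≤ B * θ ^ℚ m
      term≤ a ha m = begin
        ∣ c m * a ^ℚ m ∣        ≡⟨ ℚₚ.∣p*q∣≡∣p∣*∣q∣ (c m) (a ^ℚ m) ⟩
        ∣ c m ∣ * ∣ a ^ℚ m ∣    ≤⟨ *-monoˡ (ℚₚ.0≤∣p∣ (c m)) (∣^∣≤ ha m) ⟩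
        ∣ c m ∣ * M ^ℚ m        ≤⟨ hc m ⟩
        B * θ ^ℚ m              ∎

      tail′ : ∀ a → ∣ a ∣ ≤ M → ∀ n k → u * ∣ P (k ℕ.+ n) a - P n a ∣ ≤ B * (θ ^ℚ n - θ ^ℚ (k ℕ.+ n))
      tail′ a ha n zero    = ℚₚ.≤-reflexive (begin-equality
        u * ∣ P n a - P n a ∣       ≡⟨ cong (λ r → u * ∣ r ∣) (ℚₚ.+-inverseʳ (P n a)) ⟩
        u * 0ℚ                      ≡⟨ solve 3 (λ u b t → u :* con 0ℚ := b :* (t :- t)) refl u B (θ ^ℚ n) ⟩
        B * (θ ^ℚ n - θ ^ℚ n)       ∎)
      tail′ a ha n (suc k) = begin
        u * ∣ (P m a + t) - P n a ∣
          ≡⟨ cong (λ r → u * ∣ r ∣) (solve 3 (λ p t q → (p :+ t) :- q := (p :- q) :+ t) refl (P m a) t (P n a)) ⟩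
        u * ∣ (P m a - P n a) + t ∣
          ≤⟨ *-monoˡ 0≤u (ℚₚ.∣p+q∣≤∣p∣+∣q∣ (P m a - P n a) t) ⟩
        u * (∣ P m a - P n a ∣ + ∣ t ∣)
          ≡⟨ ℚₚ.*-distribˡ-+ u (∣ P m a - P n a ∣) (∣ t ∣) ⟩
        u * ∣ P m a - P n a ∣ + u * ∣ t ∣
          ≤⟨ ℚₚ.+-mono-≤ (tail′ a ha n k) (*-monoˡ 0≤u (term≤ a ha m)) ⟩
        B * (θ ^ℚ n - θ ^ℚ m) + u * (B * θ ^ℚ m)
          ≡⟨ solve 4 (λ θ b x y → b :* (x :- y) :+ (con 1ℚ :- θ) :* (b :* y) := b :* (x :- θ :* y)) refl θ B (θ ^ℚ n) (θ ^ℚ m) ⟩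
        B * (θ ^ℚ n - θ * θ ^ℚ m) ∎
        where
        m : ℕ
        m = k ℕ.+ n
        t : ℚ
        t = c m * a ^ℚ m

      tail : ∀ a → ∣ a ∣ ≤ M → ∀ n m → n ℕ.≤ m → u * ∣ P m a - P n a ∣ ≤ B * θ ^ℚ n
      tail a ha n m n≤m = subst (λ j → u * ∣ P j a - P n a ∣ ≤ B * θ ^ℚ n) (ℕₚ.m∸n+n≡m n≤m) (begin
        u * ∣ P (m ∸ n ℕ.+ n) a - P n a ∣     ≤⟨ tail′ a ha n (m ∸ n) ⟩
        B * (θ ^ℚ n - θ ^ℚ (m ∸ n ℕ.+ n))     ≤⟨ *-monoˡ 0≤B (p-q≤p (^-nonNeg 0≤θ (m ∸ n ℕ.+ n))) ⟩
        B * θ ^ℚ n                            ∎)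
        where
        p-q≤p : ∀ {p q} → 0ℚ ≤ q → p - q ≤ p
        p-q≤p {p} {q} 0≤q = subst (p - q ≤_) (ℚₚ.+-identityʳ p) (ℚₚ.+-monoʳ-≤ p (ℚₚ.neg-antimono-≤ 0≤q))

      module _ (a b : ℚ) (ha : ∣ a ∣ ≤ M) (hb : ∣ b ∣ ≤ M) where

        D : ℚ
        D = ∣ a - b ∣

        0≤D : 0ℚ ≤ D
        0≤D = ℚₚ.0≤∣p∣ (a - b)

        ^-lipschitz : ∀ m → M * ∣ a ^ℚ m - b ^ℚ m ∣ ≤ D * (fromℕ m * M ^ℚ m)
        ^-lipschitz zero    = ℚₚ.≤-reflexive (solve 2 (λ M d → M :* con 0ℚ := d :* (con 0ℚ :* con 1ℚ)) refl M D)
        ^-lipschitz (suc m) = begin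
          M * ∣ a * x - b * y ∣
            ≡⟨ cong (λ r → M * ∣ r ∣) (solve 4 (λ a b x y → a :* x :- b :* y := a :* (x :- y) :+ (a :- b) :* y) refl a b x y) ⟩
          M * ∣ a * (x - y) + (a - b) * y ∣
            ≤⟨ *-monoˡ 0≤M (ℚₚ.∣p+q∣≤∣p∣+∣q∣ (a * (x - y)) ((a - b) * y)) ⟩
          M * (∣ a * (x - y) ∣ + ∣ (a - b) * y ∣)
            ≡⟨ cong (M *_) (cong₂ _+_ (ℚₚ.∣p*q∣≡∣p∣*∣q∣ a (x - y)) (ℚₚ.∣p*q∣≡∣p∣*∣q∣ (a - b) y)) ⟩
          M * (∣ a ∣ * ∣ x - y ∣ + D * ∣ y ∣)
            ≤⟨ *-monoˡ 0≤M (ℚₚ.+-mono-≤ (*-monoʳ (ℚₚ.0≤∣p∣ (x - y)) ha) (*-monoˡ 0≤D (∣^∣≤ hb m))) ⟩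
          M * (M * ∣ x - y ∣ + D * z)
            ≤⟨ *-monoˡ 0≤M (ℚₚ.+-monoˡ-≤ (D * z) (^-lipschitz m)) ⟩
          M * (D * (fromℕ m * z) + D * z)
            ≡⟨ solve 4 (λ M d k z → M :* (d :* (k :* z) :+ d :* z) := d :* ((con 1ℚ :+ k) :* (M :* z))) refl M D (fromℕ m) z ⟩
          D * ((1ℚ + fromℕ m) * (M * z))
            ≡⟨ cong (λ k → D * (k * (M * z))) (fromℕ-suc m) ⟨
          D * (fromℕ (suc m) * (M * z)) ∎
          where
          x y z : ℚ
          x = a ^ℚ m
          y = b ^ℚ m
          z = M ^ℚ m

        lipschitz′ : ∀ n → M * ∣ P n a - P n b ∣ ≤ (D * B) * S n
        lipschitz′ zero    = ℚₚ.≤-reflexive (solve 2 (λ M d → M :* con 0ℚ := d :* con 0ℚ) refl M (D * B))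
        lipschitz′ (suc n) = begin
          M * ∣ (P n a + c n * x) - (P n b + c n * y) ∣
            ≡⟨ cong (λ r → M * ∣ r ∣) (solve 5 (λ p q c x y → (p :+ c :* x) :- (q :+ c :* y) := (p :- q) :+ c :* (x :- y)) refl (P n a) (P n b) (c n) x y) ⟩
          M * ∣ (P n a - P n b) + c n * (x - y) ∣
            ≤⟨ *-monoˡ 0≤M (ℚₚ.∣p+q∣≤∣p∣+∣q∣ (P n a - P n b) (c n * (x - y))) ⟩
          M * (∣ P n a - P n b ∣ + ∣ c n * (x - y) ∣)
            ≡⟨ cong (λ r → M * (∣ P n a - P n b ∣ + r)) (ℚₚ.∣p*q∣≡∣p∣*∣q∣ (c n) (x - y)) ⟩
          M * (∣ P n a - P n b ∣ + ∣ c n ∣ * ∣ x - y ∣)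
            ≡⟨ solve 4 (λ M p c d → M :* (p :+ c :* d) := M :* p :+ c :* (M :* d)) refl M (∣ P n a - P n b ∣) (∣ c n ∣) (∣ x - y ∣) ⟩
          M * ∣ P n a - P n b ∣ + ∣ c n ∣ * (M * ∣ x - y ∣)
            ≤⟨ ℚₚ.+-mono-≤ (lipschitz′ n) (*-monoˡ (ℚₚ.0≤∣p∣ (c n)) (^-lipschitz n)) ⟩
          (D * B) * S n + ∣ c n ∣ * (D * (fromℕ n * M ^ℚ n))
            ≡⟨ cong (_+_ ((D * B) * S n)) (solve 4 (λ c d k z → c :* (d :* (k :* z)) := (d :* k) :* (c :* z)) refl (∣ c n ∣) D (fromℕ n) (M ^ℚ n)) ⟩
          (D * B) * S n + (D * fromℕ n) * (∣ c n ∣ * M ^ℚ n)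
            ≤⟨ ℚₚ.+-monoʳ-≤ ((D * B) * S n) (*-monoˡ (*-nonNeg 0≤D (fromℕ-nonNeg n)) (hc n)) ⟩
          (D * B) * S n + (D * fromℕ n) * (B * θ ^ℚ n)
            ≡⟨ solve 5 (λ d b s k t → (d :* b) :* s :+ (d :* k) :* (b :* t) := (d :* b) :* (s :+ k :* t)) refl D B (S n) (fromℕ n) (θ ^ℚ n) ⟩
          (D * B) * (S n + fromℕ n * θ ^ℚ n) ∎
          where
          x y : ℚ
          x = a ^ℚ n
          y = b ^ℚ n

        lipschitz : ∀ n → ((u * u) * M) * ∣ P n a - P n b ∣ ≤ B * D
        lipschitz n = begin
          ((u * u) * M) * ∣ P n a - P n b ∣     ≡⟨ ℚₚ.*-assoc (u * u) M (∣ P n a - P n b ∣) ⟩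
          (u * u) * (M * ∣ P n a - P n b ∣)     ≤⟨ *-monoˡ (*-nonNeg 0≤u 0≤u) (lipschitz′ n) ⟩
          (u * u) * ((D * B) * S n)             ≡⟨ solve 4 (λ w d b s → w :* ((d :* b) :* s) := (b :* d) :* (w :* s)) refl (u * u) D B (S n) ⟩
          (B * D) * ((u * u) * S n)             ≤⟨ *-monoˡ (*-nonNeg 0≤B 0≤D) (uu*S≤1 n) ⟩
          (B * D) * 1ℚ                          ≡⟨ ℚₚ.*-identityʳ (B * D) ⟩
          B * D                                 ∎

      0<uuM : 0ℚ < (u * u) * M
      0<uuM = *-pos (*-pos 0<u 0<u) 0<M

      κ λ′ : ℚ
      κ  = inv u 0<u * B
      λ′ = inv ((u * u) * M) 0<uuM * B

      0≤κ : 0ℚ ≤ κ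
      0≤κ = *-nonNeg (ℚₚ.<⇒≤ (inv-pos u 0<u)) 0≤B

      0≤λ′ : 0ℚ ≤ λ′
      0≤λ′ = *-nonNeg (ℚₚ.<⇒≤ (inv-pos ((u * u) * M) 0<uuM)) 0≤B

      tail-ε : ∀ {ε} a → ∣ a ∣ ≤ M → ∀ n m → n ℕ.≤ m → θ ^ℚ n ≤ ε → ∣ P m a - P n a ∣ ≤ κ * ε
      tail-ε {ε} a ha n m n≤m θⁿ≤ε = subst (∣ P m a - P n a ∣ ≤_) (sym (ℚₚ.*-assoc (inv u 0<u) B ε))
        (r*p≤q⇒p≤r⁻¹*q 0<u (ℚₚ.≤-trans (tail a ha n m n≤m) (*-monoˡ 0≤B θⁿ≤ε)))

      lipschitz-ε : ∀ {ε} a b → ∣ a ∣ ≤ M → ∣ b ∣ ≤ M → ∀ n → ∣ a - b ∣ ≤ ε → ∣ P n a - P n b ∣ ≤ λ′ * ε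
      lipschitz-ε {ε} a b ha hb n D≤ε = subst (∣ P n a - P n b ∣ ≤_) (sym (ℚₚ.*-assoc (inv ((u * u) * M) 0<uuM) B ε))
        (r*p≤q⇒p≤r⁻¹*q 0<uuM (ℚₚ.≤-trans (lipschitz a b ha hb n) (*-monoˡ 0≤B D≤ε)))

      series-isCauchy : ∀ z → IsCauchy z → ∀ K → (∀ n → K ℕ.≤ n → ∣ z n ∣ ≤ M) →
                        IsCauchy (λ n → partialSum c n (z n))
      series-isCauchy z cz K hz =
        scaled-isCauchy (λ n → P n (z n)) (κ + λ′ + κ) (+-nonNeg (+-nonNeg 0≤κ 0≤λ′) 0≤κ) λ ε 0<ε →
          let N₁ , h₁ = cz ε 0<ε
              N₂ , h₂ = vanishes ε 0<ε
              N       = K ℕ.⊔ (N₁ ℕ.⊔ N₂)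
              K≤      = λ {m} (le : N ℕ.≤ m) → ℕₚ.m⊔n≤o⇒m≤o K (N₁ ℕ.⊔ N₂) le
              N₁≤     = λ {m} (le : N ℕ.≤ m) → ℕₚ.m⊔n≤o⇒m≤o N₁ N₂ (ℕₚ.m⊔n≤o⇒n≤o K (N₁ ℕ.⊔ N₂) le)
              N₂≤     = λ {m} (le : N ℕ.≤ m) → ℕₚ.m⊔n≤o⇒n≤o N₁ N₂ (ℕₚ.m⊔n≤o⇒n≤o K (N₁ ℕ.⊔ N₂) le)
              θ≤      = h₂ N (N₂≤ ℕₚ.≤-refl)
          in N , λ m n N≤m N≤n →
            let a  = z m
                b  = z n
                ha = hz m (K≤ N≤m)
                hb = hz n (K≤ N≤n)
            in begin
              ∣ P m a - P n b ∣
                ≡⟨ cong ∣_∣ (solve 4 (λ w x y v → w :- v := (w :- x) :+ (x :- y) :+ (y :- v)) refl (P m a) (P N a) (P N b) (P n b)) ⟩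
              ∣ (P m a - P N a) + (P N a - P N b) + (P N b - P n b) ∣
                ≤⟨ ℚₚ.∣p+q∣≤∣p∣+∣q∣ ((P m a - P N a) + (P N a - P N b)) (P N b - P n b) ⟩
              ∣ (P m a - P N a) + (P N a - P N b) ∣ + ∣ P N b - P n b ∣
                ≤⟨ ℚₚ.+-mono-≤ (ℚₚ.∣p+q∣≤∣p∣+∣q∣ (P m a - P N a) (P N a - P N b)) (ℚₚ.≤-reflexive (∣p-q∣≡∣q-p∣ (P N b) (P n b))) ⟩
              ∣ P m a - P N a ∣ + ∣ P N a - P N b ∣ + ∣ P n b - P N b ∣
                ≤⟨ ℚₚ.+-mono-≤ (ℚₚ.+-mono-≤ (tail-ε a ha N m N≤m θ≤)
                     (lipschitz-ε a b ha hb N (h₁ m n (N₁≤ N≤m) (N₁≤ N≤n)))) (tail-ε b hb N n N≤n θ≤) ⟩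
              κ * ε + λ′ * ε + κ * ε
                ≡⟨ solve 3 (λ k l e → k :* e :+ l :* e :+ k :* e := (k :+ l :+ k) :* e) refl κ λ′ ε ⟩
              (κ + λ′ + κ) * ε ∎

  0≤½ : 0ℚ ≤ ½
  0≤½ = ℚₚ.nonNegative⁻¹ ½

  ½<1 : ½ < 1ℚ
  ½<1 = ℚ.*<* (ℤ.+<+ (ℕ.s≤s (ℕ.s≤s ℕ.z≤n)))

  -- A sequence that eventually halves at each step is O(2⁻ᵐ).
  halving : ∀ K (t : ℕ → ℚ) → (∀ m → 0ℚ ≤ t m) → (∀ m → K ℕ.≤ m → t (suc m) ≤ ½ * t m) →
            ∃ λ B → 0ℚ ≤ B × (∀ m → t m ≤ B * ½ ^ℚ m)
  halving zero t 0≤t h = t 0 , 0≤t 0 , bound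
    where
    bound : ∀ m → t m ≤ t 0 * ½ ^ℚ m
    bound zero    = ℚₚ.≤-reflexive (sym (ℚₚ.*-identityʳ (t 0)))
    bound (suc m) = begin
      t (suc m)             ≤⟨ h m ℕ.z≤n ⟩
      ½ * t m               ≤⟨ *-monoˡ 0≤½ (bound m) ⟩
      ½ * (t 0 * ½ ^ℚ m)    ≡⟨ solve 3 (λ h a p → h :* (a :* p) := a :* (h :* p)) refl ½ (t 0) (½ ^ℚ m) ⟩
      t 0 * (½ * ½ ^ℚ m)    ∎
  halving (suc K) t 0≤t h =
    let B , 0≤B , hB = halving K (λ m → t (suc m)) (λ m → 0≤t (suc m)) (λ m K≤m → h (suc m) (ℕ.s≤s K≤m))
    in t 0 + (B + B) , +-nonNeg (0≤t 0) (+-nonNeg 0≤B 0≤B) , bound B 0≤B hB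
    where
    bound : ∀ B → 0ℚ ≤ B → (∀ m → t (suc m) ≤ B * ½ ^ℚ m) → ∀ m → t m ≤ (t 0 + (B + B)) * ½ ^ℚ m
    bound B 0≤B hB zero    = subst (t 0 ≤_) (sym (ℚₚ.*-identityʳ (t 0 + (B + B)))) (p≤p+q (+-nonNeg 0≤B 0≤B))
    bound B 0≤B hB (suc m) = begin
      t (suc m)                             ≤⟨ hB m ⟩
      B * ½ ^ℚ m                            ≡⟨ solve 2 (λ b p → b :* p := (b :+ b) :* (con ½ :* p)) refl B (½ ^ℚ m) ⟩
      (B + B) * (½ * ½ ^ℚ m)                ≤⟨ *-monoʳ (*-nonNeg 0≤½ (^-nonNeg 0≤½ m)) (p≤q+p (0≤t 0)) ⟩
      (t 0 + (B + B)) * (½ * ½ ^ℚ m)        ∎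

  exp-coeff-bound : ∀ M → 0ℚ < M → ∃ λ B → 0ℚ ≤ B × (∀ m → ∣ 1/! m ∣ * M ^ℚ m ≤ B * ½ ^ℚ m)
  exp-coeff-bound M 0<M = halving K t 0≤t step
    where
    0≤M : 0ℚ ≤ M
    0≤M = ℚₚ.<⇒≤ 0<M

    t : ℕ → ℚ
    t m = ∣ 1/! m ∣ * M ^ℚ m

    0≤t : ∀ m → 0ℚ ≤ t m
    0≤t m = *-nonNeg (ℚₚ.0≤∣p∣ (1/! m)) (^-nonNeg 0≤M m)

    K : ℕ
    K = proj₁ (archimedean (M + M))

    ratio : ∀ m → fromℕ (suc m) * t (suc m) ≡ M * t m
    ratio m = begin-equality
      s * (∣ 1/! (suc m) ∣ * (M * p))    ≡⟨ cong (λ a → s * (a * (M * p))) (ℚₚ.0≤p⇒∣p∣≡p (ℚₚ.<⇒≤ (1/!-pos (suc m)))) ⟩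
      s * (1/! (suc m) * (M * p))        ≡⟨ solve 4 (λ s c M p → s :* (c :* (M :* p)) := M :* ((s :* c) :* p)) refl s (1/! (suc m)) M p ⟩
      M * ((s * 1/! (suc m)) * p)        ≡⟨ cong (λ a → M * (a * p)) (1/!-suc m) ⟩
      M * (1/! m * p)                    ≡⟨ cong (λ a → M * (a * p)) (ℚₚ.0≤p⇒∣p∣≡p (ℚₚ.<⇒≤ (1/!-pos m))) ⟨
      M * (∣ 1/! m ∣ * p)                ∎
      where
      s p : ℚ
      s = fromℕ (suc m)
      p = M ^ℚ m

    step : ∀ m → K ℕ.≤ m → t (suc m) ≤ ½ * t m
    step m K≤m = cancelˡ (ℚₚ.+-mono-< 0<M 0<M) (begin
      (M + M) * t (suc m)         ≤⟨ *-monoʳ (0≤t (suc m)) (ℚₚ.≤-trans (proj₂ (archimedean (M + M))) (fromℕ-mono (ℕₚ.m≤n⇒m≤1+n K≤m))) ⟩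
      fromℕ (suc m) * t (suc m)   ≡⟨ ratio m ⟩
      M * t m                     ≡⟨ solve 2 (λ M t → M :* t := (M :+ M) :* (con ½ :* t)) refl M (t m) ⟩
      (M + M) * (½ * t m)         ∎)

  exp-isCauchy : ∀ z → IsCauchy z → IsCauchy (λ n → partialSum 1/! n (z n))
  exp-isCauchy z cz =
    let A , 0≤A , hA = cauchy-bounded z cz
        0<M          = ℚₚ.+-mono-≤-< 0≤A 0<1
        B , 0≤B , hB = exp-coeff-bound (A + 1ℚ) 0<M
    in Geometric.Series.series-isCauchy ½ 0≤½ ½<1 1/! (A + 1ℚ) B 0<M 0≤B hB z cz 0
         (λ n _ → ℚₚ.≤-trans (hA n) (p≤p+q 0≤1))

-- Coefficients of log (1 - u) = - Σ_{m≥1} uᵐ / m.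
logCoeff : ℕ → ℚ
logCoeff zero    = 0ℚ
logCoeff (suc m) = ℚ.- (1ℤ ℚ./ suc m)

module LogEstimate where

  open import Data.Rational.Base using (_+_; _*_; _-_; -_; _≤_; _<_)
  open Estimates

  ∣logCoeff∣≤1 : ∀ m → ∣ logCoeff m ∣ ≤ 1ℚ
  ∣logCoeff∣≤1 zero    = 0≤1
  ∣logCoeff∣≤1 (suc m) = subst (_≤ 1ℚ)
    (sym (trans (ℚₚ.∣-p∣≡∣p∣ (1ℤ ℚ./ suc m)) (ℚₚ.0≤p⇒∣p∣≡p (ℚₚ.<⇒≤ (1/n-pos (suc m))))))
    (1/1+n≤1 m)

  log-isCauchy : ∀ z → IsCauchy z → ∀ K θ → 0ℚ < θ → θ < 1ℚ → (∀ n → K ℕ.≤ n → ∣ z n ∣ ≤ θ) →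
                 IsCauchy (λ n → partialSum logCoeff n (z n))
  log-isCauchy z cz K θ 0<θ θ<1 hz =
    Geometric.Series.series-isCauchy θ (ℚₚ.<⇒≤ 0<θ) θ<1 logCoeff θ 1ℚ 0<θ 0≤1
      (λ m → *-monoʳ (^-nonNeg (ℚₚ.<⇒≤ 0<θ) m) (∣logCoeff∣≤1 m)) z cz K hz

record ℝ : Set where
  constructor mkℝ
  field
    seq      : ℕ → ℚ
    isCauchy : IsCauchy seq

open ℝ public

infix 4 _≃_ _≤_ _<_

_≃_ : ℝ → ℝ → Set
x ≃ y = ∀ ε → 0ℚ ℚ.< ε → ∃ λ N → ∀ n → N ℕ.≤ n → ∣ seq x n ℚ.- seq y n ∣ ℚ.≤ ε

_≤_ : ℝ → ℝ → Set
x ≤ y = ∀ ε → 0ℚ ℚ.< ε → ∃ λ N → ∀ n → N ℕ.≤ n → seq x n ℚ.≤ seq y n ℚ.+ ε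

_<_ : ℝ → ℝ → Set
x < y = ∃ λ δ → 0ℚ ℚ.< δ × ∃ λ N → ∀ n → N ℕ.≤ n → seq x n ℚ.+ δ ℚ.≤ seq y n

fromℚ : ℚ → ℝ
fromℚ p = mkℝ (λ _ → p) (Estimates.const-isCauchy p)

0ℝ 1ℝ : ℝ
0ℝ = fromℚ 0ℚ
1ℝ = fromℚ 1ℚ

infixl 6 _+_ _-_
infixl 7 _*_
infix  8 -_

_+_ : ℝ → ℝ → ℝ
x + y = mkℝ (λ n → seq x n ℚ.+ seq y n) (Estimates.+-isCauchy (seq x) (seq y) (isCauchy x) (isCauchy y))

-_ : ℝ → ℝ
- x = mkℝ (λ n → ℚ.- seq x n) (Estimates.neg-isCauchy (seq x) (isCauchy x))

_-_ : ℝ → ℝ → ℝ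
x - y = x + (- y)

_*_ : ℝ → ℝ → ℝ
x * y = mkℝ (λ n → seq x n ℚ.* seq y n) (Estimates.*-isCauchy (seq x) (seq y) (isCauchy x) (isCauchy y))

-- The witness δ of 0 < x is eventually a lower bound of the sequence of x, so
-- the maximum δ ⊔ x n, which makes every term invertible, is eventually x n.
reciprocal : (x : ℝ) → 0ℝ < x → ℝ
reciprocal x (δ , 0<δ , N , h) = mkℝ
  (λ n → Estimates.inv (δ ℚ.⊔ seq x n) (Estimates.δ⊔p>0 0<δ (seq x n)))
  (Estimates.inv-isCauchy (seq x) 0<δ
    (λ n N≤n → subst (ℚ._≤ seq x n) (ℚₚ.+-identityˡ δ) (h n N≤n)) (isCauchy x))

rawSemiring : RawSemiring 0ℓ 0ℓ
rawSemiring = record { Carrier = ℝ ; _≈_ = _≃_ ; _+_ = _+_ ; _*_ = _*_ ; 0# = 0ℝ ; 1# = 1ℝ }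

open RawSemiringDefs rawSemiring public using (_^_)

-- exp and log are the diagonal limits of n ↦ Σ_{m<n} cₘ (zₙ)ᵐ of their power
-- series; the partial sums converge uniformly on the range of the sequence z.

exp : ℝ → ℝ
exp z = mkℝ (λ n → partialSum 1/! n (seq z n)) (Estimates.exp-isCauchy (seq z) (isCauchy z))

log : (q : ℝ) → 0ℝ < q → q < 1ℝ → ℝ
log q (δ , 0<δ , N , h) (δ′ , 0<δ′ , N′ , h′) = mkℝ
  (λ n → partialSum logCoeff n (seq 1-q n))
  (LogEstimate.log-isCauchy (seq 1-q) (isCauchy 1-q) K (1ℚ ℚ.- δ)
    (ℚₚ.<-≤-trans 0<δ′ (ℚₚ.≤-trans (lower K ℕₚ.≤-refl) (upper K ℕₚ.≤-refl))) θ<1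
    (λ n K≤n → subst (ℚ._≤ 1ℚ ℚ.- δ)
      (sym (ℚₚ.0≤p⇒∣p∣≡p (ℚₚ.≤-trans (ℚₚ.<⇒≤ 0<δ′) (lower n K≤n)))) (upper n K≤n)))
  where
  1-q : ℝ
  1-q = 1ℝ - q

  K : ℕ
  K = N ℕ.⊔ N′

  lower : ∀ n → K ℕ.≤ n → δ′ ℚ.≤ 1ℚ ℚ.- seq q n
  lower n K≤n = Estimates.p+r≤q⇒r≤q-p {seq q n} (h′ n (ℕₚ.m⊔n≤o⇒n≤o N N′ K≤n))

  upper : ∀ n → K ℕ.≤ n → 1ℚ ℚ.- seq q n ℚ.≤ 1ℚ ℚ.- δ
  upper n K≤n = ℚₚ.+-monoʳ-≤ 1ℚ (ℚₚ.neg-antimono-≤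
    (subst (ℚ._≤ seq q n) (ℚₚ.+-identityˡ δ) (h n (ℕₚ.m⊔n≤o⇒m≤o N N′ K≤n))))

  θ<1 : 1ℚ ℚ.- δ ℚ.< 1ℚ
  θ<1 = subst (1ℚ ℚ.- δ ℚ.<_) (ℚₚ.+-identityʳ 1ℚ) (ℚₚ.+-monoʳ-< 1ℚ (ℚₚ.neg-antimono-< 0<δ))

FPS : Set
FPS = ℕ → ℝ

Σ≤ : ℕ → (ℕ → ℝ) → ℝ
Σ≤ zero    f = f 0
Σ≤ (suc n) f = Σ≤ n f + f (suc n)

infixl 7 _⊛_

_⊛_ : FPS → FPS → FPS
(f ⊛ g) n = Σ≤ n (λ i → f i * g (n ∸ i))

constant : ℝ → FPS
constant a zero    = a
constant a (suc n) = 0ℝ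

t^_ : ℕ → FPS
(t^ zero)  zero    = 1ℝ
(t^ zero)  (suc n) = 0ℝ
(t^ suc k) zero    = 0ℝ
(t^ suc k) (suc n) = (t^ k) n

expSeries : ℝ → FPS
expSeries a n = a ^ n * fromℚ (1/! n)

module QBernstein (q : ℝ) (0<q : 0ℝ < q) (q<1 : q < 1ℝ) where

  q^_ : ℝ → ℝ
  q^ x = exp (x * log q 0<q q<1)

  0<1-q : 0ℝ < 1ℝ - q
  0<1-q = let δ , 0<δ , N , h = q<1 in
    δ , 0<δ , N , λ n N≤n → subst (ℚ._≤ 1ℚ ℚ.- seq q n) (sym (ℚₚ.+-identityˡ δ))
      (Estimates.p+r≤q⇒r≤q-p {seq q n} (h n N≤n))

  [_] : ℝ → ℝ
  [ x ] = (1ℝ - q^ x) * reciprocal (1ℝ - q) 0<1-q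

  -- t^k e^{[1-x]t} [x]^k / k!, read as a formal power series in t.
  generatingFunction : ℕ → ℝ → FPS
  generatingFunction k x = t^ k ⊛ expSeries [ 1ℝ - x ] ⊛ constant ([ x ] ^ k * fromℚ (1/! k))

  B : ℕ → ℕ → ℝ → ℝ
  B k n x = fromℚ (fromℕ (n !)) * generatingFunction k x n

  generatingFunction-B : ∀ k x n → generatingFunction k x n ≃ B k n x * fromℚ (1/! n)
  generatingFunction-B k x n ε 0<ε = 0 , λ m _ →
    subst (λ r → ∣ r ∣ ℚ.≤ ε) (sym (cancel (seq (generatingFunction k x n) m))) (ℚₚ.<⇒≤ 0<ε)
    where
    open +-*-Solver using (solve; _:*_; _:-_; _:=_; con)

    cancel : ∀ g → g ℚ.- (fromℕ (n !) ℚ.* g) ℚ.* 1/! n ≡ 0ℚ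
    cancel g = trans
      (solve 3 (λ g f c → g :- (f :* g) :* c := g :* (con 1ℚ :- f :* c)) refl g (fromℕ (n !)) (1/! n))
      (trans (cong (λ r → g ℚ.* (1ℚ ℚ.- r)) (Estimates.n!*1/!n≡1 n)) (ℚₚ.*-zeroʳ g))

{-# OPTIONS --safe #-}

-- Write a = [x], b = [1-x].  Comparing coefficients, (n-k)/n B_{k,n} = b B_{k,n-1}
-- and (k+1)/n B_{k+1,n} = a B_{k,n-1}, so the claim is a + b = 1 + (1-q) a b, which is
-- equivalent to q^x q^(1-x) = q.  For the latter let L, E be the truncated series of
-- log (1-u) and exp.  The polynomial D(u) = E(x L(u)) E((1-x) L(u)) - (1-u) vanishes at 0
-- and satisfies D′ = - (1 + u + ... + uⁿ⁻¹) D + (an error tending to 0 uniformly on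
-- [0, θ], θ < 1); since the damping factor is nonnegative, D tends to 0 uniformly.

module Submission where

import Algebra.Definitions.RawSemiring as RawSemiringDefs
open import Data.Integer.Base using (+_; 1ℤ)
import Data.Integer.Base as ℤ
import Data.Integer.Properties as ℤₚ
open import Data.Nat.Base using (ℕ; zero; suc; pred; NonZero; _!; _∸_)
import Data.Nat.Base as ℕ
import Data.Nat.Properties as ℕₚ
open import Data.Product.Base using (∃; _×_; _,_; proj₁; proj₂)
open import Data.Rational.Base using (ℚ; 0ℚ; 1ℚ; ½; ∣_∣)
import Data.Rational.Base as ℚ
import Data.Rational.Properties as ℚₚ
import Data.Rational.Unnormalised.Base as ℚᵘ
import Data.Rational.Unnormalised.Properties as ℚᵘₚ
open import Data.Rational.Solver using (module +-*-Solver)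
open import Relation.Binary.PropositionalEquality using (_≡_; refl; sym; trans; cong; cong₂; subst; subst₂; module ≡-Reasoning)

open import Defs using (module Estimates; partialSum; fromℕ; 1/!; logCoeff; module LogEstimate)
open Estimates
open RawSemiringDefs ℚ.+-*-rawSemiring using () renaming (_^_ to _^ℚ_)

-- Bounded functions and derivatives on the unit interval.

module Calculus where

  open import Data.Rational.Base using (_+_; _*_; _-_; -_; _≤_; _<_)
  open +-*-Solver using (solve; _:+_; _:*_; _:-_; _:=_; con)
  open ℚₚ.≤-Reasoning

  ≤-by-ε : ∀ {p q} → (∀ ε → 0ℚ < ε → p ≤ q + ε) → p ≤ q
  ≤-by-ε {p} {q} h = ℚₚ.≮⇒≥ λ q<p →
    let m , q<m , m<p = ℚₚ.<-dense q<p
    in ℚₚ.<-irrefl refl (ℚₚ.≤-<-trans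
         (subst (p ≤_) (solve 2 (λ q m → q :+ (m :- q) := m) refl q m) (h (m - q) (p<q⇒0<q-p q<m))) m<p)

  Unit : ℚ → Set
  Unit u = 0ℚ ≤ u × u ≤ 1ℚ

  -- Two arguments, because a Taylor remainder depends on both points. A function of one point is
  -- treated as a function that ignores the other.
  Bounded : (ℚ → ℚ → ℚ) → Set
  Bounded φ = ∃ λ C → 0ℚ ≤ C × (∀ {u v} → Unit u → Unit v → ∣ φ u v ∣ ≤ C)

  bounded-cong : ∀ {φ ψ} → (∀ u v → φ u v ≡ ψ u v) → Bounded φ → Bounded ψ
  bounded-cong φ≗ψ (C , 0≤C , h) = C , 0≤C , λ {u} {v} hu hv → subst (λ r → ∣ r ∣ ≤ C) (φ≗ψ u v) (h hu hv)

  const-bounded : ∀ c → Bounded (λ _ _ → c)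
  const-bounded c = ∣ c ∣ , ℚₚ.0≤∣p∣ c , λ _ _ → ℚₚ.≤-refl

  id-bounded : Bounded (λ u _ → u)
  id-bounded = 1ℚ , 0≤1 , λ (0≤u , u≤1) _ → subst (_≤ 1ℚ) (sym (ℚₚ.0≤p⇒∣p∣≡p 0≤u)) u≤1

  swap-bounded : ∀ {φ} → Bounded φ → Bounded (λ u v → φ v u)
  swap-bounded (C , 0≤C , h) = C , 0≤C , λ hu hv → h hv hu

  +-bounded : ∀ {φ ψ} → Bounded φ → Bounded ψ → Bounded (λ u v → φ u v + ψ u v)
  +-bounded {φ} {ψ} (C , 0≤C , h) (D , 0≤D , g) = C + D , +-nonNeg 0≤C 0≤D , λ {u} {v} hu hv →
    ℚₚ.≤-trans (ℚₚ.∣p+q∣≤∣p∣+∣q∣ (φ u v) (ψ u v)) (ℚₚ.+-mono-≤ (h hu hv) (g hu hv))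

  ∣p*q∣≤ : ∀ {p q C D} → ∣ p ∣ ≤ C → ∣ q ∣ ≤ D → ∣ p * q ∣ ≤ C * D
  ∣p*q∣≤ {p} {q} {C} {D} hp hq = subst (_≤ C * D) (sym (ℚₚ.∣p*q∣≡∣p∣*∣q∣ p q))
    (*-mono (ℚₚ.≤-trans (ℚₚ.0≤∣p∣ p) hp) (ℚₚ.0≤∣p∣ q) hp hq)

  ∣p+q∣≤ : ∀ {p q C D} → ∣ p ∣ ≤ C → ∣ q ∣ ≤ D → ∣ p + q ∣ ≤ C + D
  ∣p+q∣≤ {p} {q} hp hq = ℚₚ.≤-trans (ℚₚ.∣p+q∣≤∣p∣+∣q∣ p q) (ℚₚ.+-mono-≤ hp hq)

  *-bounded : ∀ {φ ψ} → Bounded φ → Bounded ψ → Bounded (λ u v → φ u v * ψ u v)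
  *-bounded {φ} {ψ} (C , 0≤C , h) (D , 0≤D , g) = C * D , *-nonNeg 0≤C 0≤D , λ {u} {v} hu hv →
    ∣p*q∣≤ {φ u v} {ψ u v} (h hu hv) (g hu hv)

  difference-bounded : Bounded (λ u v → v - u)
  difference-bounded = bounded-cong (λ u v → solve 2 (λ u v → v :+ con (- 1ℚ) :* u := v :- u) refl u v)
    (+-bounded (swap-bounded id-bounded) (*-bounded (const-bounded (- 1ℚ)) id-bounded))

  -- Differentiability on [0, 1] with a bounded second-order remainder.
  record HasDerivative (f f′ : ℚ → ℚ) : Set where
    field
      remainder          : ℚ → ℚ → ℚ
      taylor             : ∀ u v → f v ≡ f u + f′ u * (v - u) + remainder u v * ((v - u) * (v - u))
      bounded            : Bounded (λ u _ → f u)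
      derivative-bounded : Bounded (λ u _ → f′ u)
      remainder-bounded  : Bounded remainder

  open HasDerivative

  derivative-cong : ∀ {f f′ g′} → (∀ u → f′ u ≡ g′ u) → HasDerivative f f′ → HasDerivative f g′
  derivative-cong {f} f′≗g′ d = record
    { remainder          = remainder d
    ; taylor             = λ u v → trans (taylor d u v)
        (cong (λ r → f u + r * (v - u) + remainder d u v * ((v - u) * (v - u))) (f′≗g′ u))
    ; bounded            = bounded d
    ; derivative-bounded = bounded-cong (λ u _ → f′≗g′ u) (derivative-bounded d)
    ; remainder-bounded  = remainder-bounded d
    }

  const-derivative : ∀ c → HasDerivative (λ _ → c) (λ _ → 0ℚ)
  const-derivative c = record
    { remainder          = λ _ _ → 0ℚ
    ; taylor             = λ u v → solve 2 (λ c h → c := c :+ con 0ℚ :* h :+ con 0ℚ :* (h :* h)) refl c (v - u)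
    ; bounded            = const-bounded c
    ; derivative-bounded = const-bounded 0ℚ
    ; remainder-bounded  = const-bounded 0ℚ
    }

  id-derivative : HasDerivative (λ u → u) (λ _ → 1ℚ)
  id-derivative = record
    { remainder          = λ _ _ → 0ℚ
    ; taylor             = λ u v → solve 2 (λ u v → v := u :+ con 1ℚ :* (v :- u) :+ con 0ℚ :* ((v :- u) :* (v :- u))) refl u v
    ; bounded            = id-bounded
    ; derivative-bounded = const-bounded 1ℚ
    ; remainder-bounded  = const-bounded 0ℚ
    }

  +-derivative : ∀ {f f′ g g′} → HasDerivative f f′ → HasDerivative g g′ →
                 HasDerivative (λ u → f u + g u) (λ u → f′ u + g′ u)
  +-derivative {f} {f′} {g} {g′} d e = record
    { remainder          = λ u v → remainder d u v + remainder e u v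
    ; taylor             = λ u v → trans (cong₂ _+_ (taylor d u v) (taylor e u v))
        (solve 7 (λ f f′ r g g′ s h → (f :+ f′ :* h :+ r :* (h :* h)) :+ (g :+ g′ :* h :+ s :* (h :* h))
           := (f :+ g) :+ (f′ :+ g′) :* h :+ (r :+ s) :* (h :* h))
           refl (f u) (f′ u) (remainder d u v) (g u) (g′ u) (remainder e u v) (v - u))
    ; bounded            = +-bounded (bounded d) (bounded e)
    ; derivative-bounded = +-bounded (derivative-bounded d) (derivative-bounded e)
    ; remainder-bounded  = +-bounded (remainder-bounded d) (remainder-bounded e)
    }

  *-derivative : ∀ {f f′ g g′} → HasDerivative f f′ → HasDerivative g g′ →
                 HasDerivative (λ u → f u * g u) (λ u → f′ u * g u + f u * g′ u)
  *-derivative {f} {f′} {g} {g′} d e = record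
    -- The remainder of f multiplies all of `g v`, left unexpanded so that the bound on g applies to
    -- it directly. The `taylor` field expands `g v` for the ring identity and then folds it back.
    { remainder          = λ u v →
        remainder d u v * g v + f u * remainder e u v + f′ u * (g′ u + remainder e u v * (v - u))
    ; taylor             = λ u v → trans (cong (_* g v) (taylor d u v)) (trans
        (cong ((f u + f′ u * (v - u) + remainder d u v * ((v - u) * (v - u))) *_) (taylor e u v))
        (trans
          (solve 7 (λ f f′ r g g′ s h →
             (f :+ f′ :* h :+ r :* (h :* h)) :* (g :+ g′ :* h :+ s :* (h :* h))
             := f :* g :+ (f′ :* g :+ f :* g′) :* h
                :+ (r :* (g :+ g′ :* h :+ s :* (h :* h)) :+ f :* s :+ f′ :* (g′ :+ s :* h)) :* (h :* h))
             refl (f u) (f′ u) (remainder d u v) (g u) (g′ u) (remainder e u v) (v - u))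
          (cong (λ w → f u * g u + (f′ u * g u + f u * g′ u) * (v - u)
             + (remainder d u v * w + f u * remainder e u v + f′ u * (g′ u + remainder e u v * (v - u)))
               * ((v - u) * (v - u))) (sym (taylor e u v)))))
    ; bounded            = *-bounded (bounded d) (bounded e)
    ; derivative-bounded = +-bounded (*-bounded (derivative-bounded d) (bounded e))
                                     (*-bounded (bounded d) (derivative-bounded e))
    ; remainder-bounded  = +-bounded
        (+-bounded (*-bounded (remainder-bounded d) (swap-bounded (bounded e)))
                   (*-bounded (bounded d) (remainder-bounded e)))
        (*-bounded (derivative-bounded d)
          (+-bounded (derivative-bounded e) (*-bounded (remainder-bounded e) difference-bounded)))
    }

  scale-derivative : ∀ {f f′} c → HasDerivative f f′ → HasDerivative (λ u → c * f u) (λ u → c * f′ u)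
  scale-derivative {f} {f′} c d = derivative-cong
    (λ u → solve 3 (λ c f f′ → con 0ℚ :* f :+ c :* f′ := c :* f′) refl c (f u) (f′ u))
    (*-derivative (const-derivative c) d)

  ^-derivative : ∀ {f f′} → HasDerivative f f′ → ∀ n →
                 HasDerivative (λ u → f u ^ℚ suc n) (λ u → fromℕ (suc n) * (f u ^ℚ n * f′ u))
  ^-derivative {f} {f′} d zero = derivative-cong
    (λ u → solve 2 (λ f f′ → f′ :* con 1ℚ :+ f :* con 0ℚ := con 1ℚ :* (con 1ℚ :* f′)) refl (f u) (f′ u))
    (*-derivative d (const-derivative 1ℚ))
  ^-derivative {f} {f′} d (suc n) = derivative-cong
    (λ u → trans
      (solve 4 (λ f f′ p k → f′ :* (f :* p) :+ f :* (k :* (p :* f′)) := (con 1ℚ :+ k) :* (f :* p :* f′))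
        refl (f u) (f′ u) (f u ^ℚ n) (fromℕ (suc n)))
      (cong (_* (f u ^ℚ suc n * f′ u)) (sym (fromℕ-suc (suc n)))))
    (*-derivative d (^-derivative d n))

  -- Termwise differentiation combined with the chain rule. The truncation loses one term, so a
  -- truncated exponential differs from its own derivative by exactly its last term; this is the
  -- source of the truncation errors below.
  partialSum-derivative : ∀ c c′ → (∀ m → fromℕ (suc m) * c (suc m) ≡ c′ m) →
    ∀ {f f′} → HasDerivative f f′ → ∀ n →
    HasDerivative (λ u → partialSum c (suc n) (f u)) (λ u → f′ u * partialSum c′ n (f u))
  partialSum-derivative c c′ hc {f} {f′} d zero = derivative-cong
    (λ u → sym (ℚₚ.*-zeroʳ (f′ u))) (const-derivative (0ℚ + c 0 * 1ℚ))
  partialSum-derivative c c′ hc {f} {f′} d (suc n) = derivative-cong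
    (λ u → trans
      (solve 5 (λ f′ s c k p → f′ :* s :+ c :* (k :* (p :* f′)) := f′ :* (s :+ (k :* c) :* p))
        refl (f′ u) (partialSum c′ n (f u)) (c (suc n)) (fromℕ (suc n)) (f u ^ℚ n))
      (cong (λ r → f′ u * (partialSum c′ n (f u) + r * f u ^ℚ n)) (hc n)))
    (+-derivative (partialSum-derivative c c′ hc d n) (scale-derivative (c (suc n)) (^-derivative d n)))

  -- Euler's method for a damped differential inequality.

  C≤nε⇒C/n≤ε : ∀ {C ε} n → C ≤ fromℕ (suc n) * ε → C * (1ℤ ℚ./ suc n) ≤ ε
  C≤nε⇒C/n≤ε {C} {ε} n h = begin
    C * i                        ≤⟨ *-monoʳ (ℚₚ.<⇒≤ (1/n-pos (suc n))) h ⟩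
    (fromℕ (suc n) * ε) * i      ≡⟨ solve 3 (λ k e i → (k :* e) :* i := (k :* i) :* e) refl (fromℕ (suc n)) ε i ⟩
    (fromℕ (suc n) * i) * ε      ≡⟨ cong (_* ε) (n*1/n≡1 (suc n)) ⟩
    1ℚ * ε                       ≡⟨ ℚₚ.*-identityˡ ε ⟩
    ε                            ∎
    where
    i : ℚ
    i = 1ℤ ℚ./ suc n

  -- A solution of f′ = - m f + O(η) with damping m ≥ 0 grows by at most η: in an
  -- Euler step of length h ≤ 1/M the factor 1 - m h lies in [0, 1].
  module Damped {f f′ : ℚ → ℚ} (d : HasDerivative f f′) (m : ℚ → ℚ) {x M η : ℚ} (x∈ : Unit x)
    (0≤m : ∀ u → 0ℚ ≤ u → u ≤ x → 0ℚ ≤ m u) (m≤M : ∀ u → 0ℚ ≤ u → u ≤ x → m u ≤ M)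
    (f′+mf≤η : ∀ u → 0ℚ ≤ u → u ≤ x → ∣ f′ u + m u * f u ∣ ≤ η) where

    0≤x : 0ℚ ≤ x
    0≤x = proj₁ x∈

    x≤1 : x ≤ 1ℚ
    x≤1 = proj₂ x∈

    C : ℚ
    C = proj₁ (remainder-bounded d)

    0≤C : 0ℚ ≤ C
    0≤C = proj₁ (proj₂ (remainder-bounded d))

    0≤M : 0ℚ ≤ M
    0≤M = ℚₚ.≤-trans (0≤m 0ℚ ℚₚ.≤-refl 0≤x) (m≤M 0ℚ ℚₚ.≤-refl 0≤x)

    0≤η : 0ℚ ≤ η
    0≤η = ℚₚ.≤-trans (ℚₚ.0≤∣p∣ (f′ 0ℚ + m 0ℚ * f 0ℚ)) (f′+mf≤η 0ℚ ℚₚ.≤-refl 0≤x)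

    euler-step : ∀ u h → 0ℚ ≤ u → 0ℚ ≤ h → h + u ≤ x → M * h ≤ 1ℚ →
                 ∣ f (h + u) ∣ ≤ ∣ f u ∣ + (η * h + C * (h * h))
    euler-step u h 0≤u 0≤h h+u≤x Mh≤1 = begin
      ∣ f (h + u) ∣
        ≡⟨ cong ∣_∣ (taylor d u (h + u)) ⟩
      ∣ f u + f′ u * (h + u - u) + r * ((h + u - u) * (h + u - u)) ∣
        -- Adding and subtracting `m u * h * f u` separates the contraction factor `1 - m h` from
        -- the residual `f′ + m f`, which is at most η.
        ≡⟨ cong ∣_∣ (solve 6 (λ f f′ h u r m → f :+ f′ :* (h :+ u :- u) :+ r :* ((h :+ u :- u) :* (h :+ u :- u))
             := (con 1ℚ :- m :* h) :* f :+ ((f′ :+ m :* f) :* h :+ r :* (h :* h))) refl (f u) (f′ u) h u r (m u)) ⟩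
      ∣ (1ℚ - m u * h) * f u + ((f′ u + m u * f u) * h + r * (h * h)) ∣
        ≤⟨ ∣p+q∣≤ {(1ℚ - m u * h) * f u} {(f′ u + m u * f u) * h + r * (h * h)}
             (∣p*q∣≤ {1ℚ - m u * h} {f u} factor≤1 ℚₚ.≤-refl)
             (∣p+q∣≤ {(f′ u + m u * f u) * h} {r * (h * h)}
               (∣p*q∣≤ {f′ u + m u * f u} {h} (f′+mf≤η u 0≤u u≤x) (∣p∣≤p 0≤h))
               (∣p*q∣≤ {r} {h * h} (proj₂ (proj₂ (remainder-bounded d)) u∈ h+u∈) (∣p∣≤p (*-nonNeg 0≤h 0≤h)))) ⟩
      1ℚ * ∣ f u ∣ + (η * h + C * (h * h))
        ≡⟨ cong (_+ (η * h + C * (h * h))) (ℚₚ.*-identityˡ (∣ f u ∣)) ⟩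
      ∣ f u ∣ + (η * h + C * (h * h)) ∎
      where
      r : ℚ
      r = remainder d u (h + u)

      ∣p∣≤p : ∀ {p} → 0ℚ ≤ p → ∣ p ∣ ≤ p
      ∣p∣≤p 0≤p = ℚₚ.≤-reflexive (ℚₚ.0≤p⇒∣p∣≡p 0≤p)

      u≤x : u ≤ x
      u≤x = ℚₚ.≤-trans (p≤q+p 0≤h) h+u≤x

      u∈ : Unit u
      u∈ = 0≤u , ℚₚ.≤-trans u≤x x≤1

      h+u∈ : Unit (h + u)
      h+u∈ = +-nonNeg 0≤h 0≤u , ℚₚ.≤-trans h+u≤x x≤1

      mh≤1 : m u * h ≤ 1ℚ
      mh≤1 = ℚₚ.≤-trans (*-monoʳ 0≤h (m≤M u 0≤u u≤x)) Mh≤1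

      factor≤1 : ∣ 1ℚ - m u * h ∣ ≤ 1ℚ
      factor≤1 = subst (_≤ 1ℚ)
        (sym (ℚₚ.0≤p⇒∣p∣≡p (p+r≤q⇒r≤q-p {m u * h} (subst (_≤ 1ℚ) (sym (ℚₚ.+-identityʳ (m u * h))) mh≤1))))
        (subst (1ℚ - m u * h ≤_) (ℚₚ.+-identityʳ 1ℚ)
          (ℚₚ.+-monoʳ-≤ 1ℚ (ℚₚ.neg-antimono-≤ (*-nonNeg (0≤m u 0≤u u≤x) 0≤h))))

    module Subdivision (k : ℕ) (M≤ : M ≤ fromℕ (suc k)) where

      i h : ℚ
      i = 1ℤ ℚ./ suc k
      h = x * i

      0≤i : 0ℚ ≤ i
      0≤i = ℚₚ.<⇒≤ (1/n-pos (suc k))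

      0≤h : 0ℚ ≤ h
      0≤h = *-nonNeg 0≤x 0≤i

      h≤i : h ≤ i
      h≤i = subst (h ≤_) (ℚₚ.*-identityˡ i) (*-monoʳ 0≤i x≤1)

      Mh≤1 : M * h ≤ 1ℚ
      Mh≤1 = ℚₚ.≤-trans (*-monoˡ 0≤M h≤i)
        (C≤nε⇒C/n≤ε k (subst (M ≤_) (sym (ℚₚ.*-identityʳ (fromℕ (suc k)))) M≤))

      N*h≡x : fromℕ (suc k) * h ≡ x
      N*h≡x = begin-equality
        fromℕ (suc k) * (x * i)  ≡⟨ solve 3 (λ a b c → a :* (b :* c) := b :* (a :* c)) refl (fromℕ (suc k)) x i ⟩
        x * (fromℕ (suc k) * i)  ≡⟨ cong (x *_) (n*1/n≡1 (suc k)) ⟩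
        x * 1ℚ                   ≡⟨ ℚₚ.*-identityʳ x ⟩
        x                        ∎

      fromℕ-suc-* : ∀ j p → fromℕ (suc j) * p ≡ p + fromℕ j * p
      fromℕ-suc-* j p = trans (cong (_* p) (fromℕ-suc j))
        (solve 2 (λ a b → (con 1ℚ :+ a) :* b := b :+ a :* b) refl (fromℕ j) p)

      walk : ∀ j → j ℕ.≤ suc k → ∣ f (fromℕ j * h) ∣ ≤ ∣ f 0ℚ ∣ + fromℕ j * (η * h + C * (h * h))
      walk zero    _  = ℚₚ.≤-reflexive (trans (cong (λ r → ∣ f r ∣) (ℚₚ.*-zeroˡ h))
        (solve 2 (λ a b → a := a :+ con 0ℚ :* b) refl (∣ f 0ℚ ∣) (η * h + C * (h * h))))
      walk (suc j) j< = begin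
        ∣ f (fromℕ (suc j) * h) ∣
          ≡⟨ cong (λ r → ∣ f r ∣) (fromℕ-suc-* j h) ⟩
        ∣ f (h + fromℕ j * h) ∣
          ≤⟨ euler-step (fromℕ j * h) h (*-nonNeg (fromℕ-nonNeg j) 0≤h) 0≤h
               (subst₂ _≤_ (fromℕ-suc-* j h) N*h≡x (*-monoʳ 0≤h (fromℕ-mono j<))) Mh≤1 ⟩
        ∣ f (fromℕ j * h) ∣ + e
          ≤⟨ ℚₚ.+-monoˡ-≤ e (walk j (ℕₚ.≤-trans (ℕₚ.n≤1+n j) j<)) ⟩
        ∣ f 0ℚ ∣ + fromℕ j * e + e
          ≡⟨ solve 3 (λ a b c → a :+ b :+ c := a :+ (c :+ b)) refl (∣ f 0ℚ ∣) (fromℕ j * e) e ⟩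
        ∣ f 0ℚ ∣ + (e + fromℕ j * e)
          ≡⟨ cong (_+_ (∣ f 0ℚ ∣)) (fromℕ-suc-* j e) ⟨
        ∣ f 0ℚ ∣ + fromℕ (suc j) * e ∎
        where
        e : ℚ
        e = η * h + C * (h * h)

      -- The k + 1 steps have total length x ≤ 1, so the first-order errors add up to at most η.
      -- Each second-order error carries an extra factor h ≤ 1 / (k + 1), so together they
      -- contribute at most `C * i`.
      endpoint : ∣ f x ∣ ≤ ∣ f 0ℚ ∣ + η + C * i
      endpoint = begin
        ∣ f x ∣                                                   ≡⟨ cong (λ r → ∣ f r ∣) N*h≡x ⟨
        ∣ f (fromℕ (suc k) * h) ∣                                 ≤⟨ walk (suc k) ℕₚ.≤-refl ⟩
        ∣ f 0ℚ ∣ + fromℕ (suc k) * (η * h + C * (h * h))          ≡⟨ solve 5 (λ a k η h C → a :+ k :* (η :* h :+ C :* (h :* h))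
                                                                       := a :+ η :* (k :* h) :+ C :* ((k :* h) :* h)) refl (∣ f 0ℚ ∣) (fromℕ (suc k)) η h C ⟩
        ∣ f 0ℚ ∣ + η * (fromℕ (suc k) * h) + C * ((fromℕ (suc k) * h) * h)
                                                                  ≡⟨ cong (λ r → ∣ f 0ℚ ∣ + η * r + C * (r * h)) N*h≡x ⟩
        ∣ f 0ℚ ∣ + η * x + C * (x * h)                            ≤⟨ ℚₚ.+-mono-≤ (ℚₚ.+-monoʳ-≤ (∣ f 0ℚ ∣) (*-monoˡ 0≤η x≤1))
                                                                       (*-monoˡ 0≤C (*-mono 0≤1 0≤h x≤1 h≤i)) ⟩
        ∣ f 0ℚ ∣ + η * 1ℚ + C * (1ℚ * i)                          ≡⟨ cong₂ (λ r s → ∣ f 0ℚ ∣ + r + C * s) (ℚₚ.*-identityʳ η) (ℚₚ.*-identityˡ i) ⟩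
        ∣ f 0ℚ ∣ + η + C * i                                      ∎

    growth≤η : ∣ f x ∣ ≤ ∣ f 0ℚ ∣ + η
    growth≤η = ≤-by-ε λ ε 0<ε →
      let j      = inv ε 0<ε
          0≤j    = ℚₚ.<⇒≤ (inv-pos ε 0<ε)
          -- One k serves two purposes: k + 1 ≥ M makes the Euler step admissible, and k + 1 ≥ C / ε
          -- pushes the accumulated second-order error below ε.
          k , T≤ = archimedean (C * j + M)
          T≤N    = ℚₚ.≤-trans T≤ (fromℕ-mono (ℕₚ.n≤1+n k))
          C≤Nε : C ≤ fromℕ (suc k) * ε
          C≤Nε = begin
            C                    ≡⟨ ℚₚ.*-identityʳ C ⟨
            C * 1ℚ               ≡⟨ cong (C *_) (inv-inverseˡ ε 0<ε) ⟨
            C * (j * ε)          ≡⟨ ℚₚ.*-assoc C j ε ⟨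
            C * j * ε            ≤⟨ *-monoʳ (ℚₚ.<⇒≤ 0<ε) (ℚₚ.≤-trans (p≤p+q {C * j} 0≤M) T≤N) ⟩
            fromℕ (suc k) * ε    ∎
      in ℚₚ.≤-trans (Subdivision.endpoint k (ℚₚ.≤-trans (p≤q+p (*-nonNeg 0≤C 0≤j)) T≤N))
           (ℚₚ.+-monoʳ-≤ (∣ f 0ℚ ∣ + η) (C≤nε⇒C/n≤ε k C≤Nε))

-- Truncated exponential and logarithm series, and uniform decay of the defect.

module ExpLog where

  open import Data.Rational.Base using (_+_; _*_; _-_; -_; _≤_; _<_)
  open +-*-Solver using (solve; _:+_; _:*_; _:-_; :-_; _:=_; con)
  open ℚₚ.≤-Reasoning
  open Calculus

  E L geometric : ℕ → ℚ → ℚ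
  E         = partialSum 1/!
  L         = partialSum logCoeff
  geometric = partialSum (λ _ → 1ℚ)

  geometric-closed : ∀ n u → (1ℚ - u) * geometric n u ≡ 1ℚ - u ^ℚ n
  geometric-closed zero    u = ℚₚ.*-zeroʳ (1ℚ - u)
  geometric-closed (suc n) u = begin-equality
    (1ℚ - u) * (geometric n u + 1ℚ * p)       ≡⟨ solve 3 (λ u g p → (con 1ℚ :- u) :* (g :+ con 1ℚ :* p) := (con 1ℚ :- u) :* g :+ (con 1ℚ :- u) :* p) refl u (geometric n u) p ⟩
    (1ℚ - u) * geometric n u + (1ℚ - u) * p   ≡⟨ cong (_+ (1ℚ - u) * p) (geometric-closed n u) ⟩
    1ℚ - p + (1ℚ - u) * p                     ≡⟨ solve 2 (λ u p → con 1ℚ :- p :+ (con 1ℚ :- u) :* p := con 1ℚ :- u :* p) refl u p ⟩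
    1ℚ - u * p                                ∎
    where
    p : ℚ
    p = u ^ℚ n

  geometric-nonNeg : ∀ n {u} → 0ℚ ≤ u → 0ℚ ≤ geometric n u
  geometric-nonNeg zero    0≤u = ℚₚ.≤-refl
  geometric-nonNeg (suc n) 0≤u = +-nonNeg (geometric-nonNeg n 0≤u) (*-nonNeg 0≤1 (^-nonNeg 0≤u n))

  partialSum-neg : ∀ c n u → partialSum (λ m → - c m) n u ≡ - partialSum c n u
  partialSum-neg c zero    u = refl
  partialSum-neg c (suc n) u = trans (cong (_+ - c n * u ^ℚ n) (partialSum-neg c n u))
    (solve 3 (λ s c p → :- s :+ (:- c) :* p := :- (s :+ c :* p)) refl (partialSum c n u) (c n) (u ^ℚ n))

  partialSum-0 : ∀ c n → partialSum c (suc n) 0ℚ ≡ c 0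
  partialSum-0 c zero    = solve 1 (λ c → con 0ℚ :+ c :* con 1ℚ := c) refl (c 0)
  partialSum-0 c (suc n) = trans (cong (_+ c (suc n) * (0ℚ * 0ℚ ^ℚ n)) (partialSum-0 c n))
    (solve 3 (λ a c p → a :+ c :* (con 0ℚ :* p) := a) refl (c 0) (c (suc n)) (0ℚ ^ℚ n))

  logCoeff-suc : ∀ m → fromℕ (suc m) * logCoeff (suc m) ≡ - 1ℚ
  logCoeff-suc m = trans (sym (ℚₚ.neg-distribʳ-* (fromℕ (suc m)) (1ℤ ℚ./ suc m))) (cong -_ (n*1/n≡1 (suc m)))

  L-derivative : ∀ n → HasDerivative (L (suc n)) (λ u → - geometric n u)
  L-derivative n = derivative-cong
    (λ u → trans (ℚₚ.*-identityˡ (partialSum (λ _ → - 1ℚ) n u)) (partialSum-neg (λ _ → 1ℚ) n u))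
    (partialSum-derivative logCoeff (λ _ → - 1ℚ) logCoeff-suc id-derivative n)

  -- The truncation of exp (x log (1 - u)) exp ((1 - x) log (1 - u)) - (1 - u).
  defect : ℕ → ℚ → ℚ → ℚ
  defect n x u = E n (x * L n u) * E n ((1ℚ - x) * L n u) + (u + - 1ℚ)

  -- `L` vanishes at 0 because `logCoeff 0` is 0, so both exponentials reduce to their constant term
  -- 1. The length is a successor because the empty truncation of exp is 0 instead of 1.
  defect-0 : ∀ n x → defect (suc n) x 0ℚ ≡ 0ℚ
  defect-0 n x = cong₂ (λ a b → a * b + (0ℚ + - 1ℚ)) (E∘L-0 x) (E∘L-0 (1ℚ - x))
    where
    E∘L-0 : ∀ y → E (suc n) (y * L (suc n) 0ℚ) ≡ 1ℚ
    E∘L-0 y = trans (cong (λ r → E (suc n) (y * r)) (partialSum-0 logCoeff n))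
      (trans (cong (E (suc n)) (ℚₚ.*-zeroʳ y)) (partialSum-0 1/! n))

  -- The gap between `E (suc n)` and its derivative `E n`.
  term : ℕ → ℚ → ℚ
  term n z = 1/! n * z ^ℚ n

  -- Kept in the literal shape that the sum and product rules produce, so that `defect-derivative`
  -- needs no rewriting.
  defect′ : ℕ → ℚ → ℚ → ℚ
  defect′ n x u =
    (x * - geometric n u * E n (x * l) * E (suc n) ((1ℚ - x) * l)
      + E (suc n) (x * l) * ((1ℚ - x) * - geometric n u * E n ((1ℚ - x) * l))) + (1ℚ + 0ℚ)
    where
    l : ℚ
    l = L (suc n) u

  defect-derivative : ∀ n x → HasDerivative (defect (suc n) x) (defect′ n x)
  defect-derivative n x = +-derivative (*-derivative (E∘L-derivative x) (E∘L-derivative (1ℚ - x)))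
    (+-derivative id-derivative (const-derivative (- 1ℚ)))
    where
    E∘L-derivative : ∀ y → HasDerivative (λ u → E (suc n) (y * L (suc n) u))
                                         (λ u → y * - geometric n u * E n (y * L (suc n) u))
    E∘L-derivative y = partialSum-derivative 1/! 1/! 1/!-suc (scale-derivative y (L-derivative n)) n

  -- Writing each `E n` as `E (suc n)` minus its last term, the two product-rule summands combine,
  -- by x + (1 - x) = 1, into minus the damping factor times the full product, and the added
  -- multiple of the defect cancels it. What is left is 1 - (1 - u) (1 + ... + u^(n-1)) = u^n and
  -- the two last-term corrections.
  defect-equation : ∀ n x u → let l = L (suc n) u in
    defect′ n x u + geometric n u * defect (suc n) x u
      ≡ u ^ℚ n + geometric n u * (x * term n (x * l) * E (suc n) ((1ℚ - x) * l)
                                 + (1ℚ - x) * term n ((1ℚ - x) * l) * E (suc n) (x * l))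
  defect-equation n x u = begin-equality
    defect′ n x u + g * defect (suc n) x u
      ≡⟨ solve 7 (λ x g a s b t u →
           ((x :* (:- g) :* a :* (b :+ t) :+ (a :+ s) :* ((con 1ℚ :- x) :* (:- g) :* b)) :+ (con 1ℚ :+ con 0ℚ))
             :+ g :* ((a :+ s) :* (b :+ t) :+ (u :+ con (- 1ℚ)))
           := (con 1ℚ :- (con 1ℚ :- u) :* g) :+ g :* (x :* s :* (b :+ t) :+ (con 1ℚ :- x) :* t :* (a :+ s)))
           refl x g (E n (x * l)) (term n (x * l)) (E n ((1ℚ - x) * l)) (term n ((1ℚ - x) * l)) u ⟩
    (1ℚ - (1ℚ - u) * g) + r
      ≡⟨ cong (λ w → (1ℚ - w) + r) (geometric-closed n u) ⟩
    (1ℚ - (1ℚ - u ^ℚ n)) + r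
      ≡⟨ solve 2 (λ p r → (con 1ℚ :- (con 1ℚ :- p)) :+ r := p :+ r) refl (u ^ℚ n) r ⟩
    u ^ℚ n + r ∎
    where
    g l r : ℚ
    g = geometric n u
    l = L (suc n) u
    r = g * (x * term n (x * l) * E (suc n) ((1ℚ - x) * l) + (1ℚ - x) * term n ((1ℚ - x) * l) * E (suc n) (x * l))

  module SeriesBound (θ : ℚ) (0≤θ : 0ℚ ≤ θ) (θ<1 : θ < 1ℚ) (c : ℕ → ℚ) (M B : ℚ) (0<M : 0ℚ < M) (0≤B : 0ℚ ≤ B)
                     (hc : ∀ m → ∣ c m ∣ * M ^ℚ m ≤ B * θ ^ℚ m) where

    open Geometric.Series θ 0≤θ θ<1 c M B 0<M 0≤B hc public using (κ; 0≤κ; term≤; tail-ε)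

    partialSum≤κ : ∀ a → ∣ a ∣ ≤ M → ∀ n → ∣ partialSum c n a ∣ ≤ κ
    -- This is the tail estimate starting at index 0, where the partial sum is 0 and the power of θ
    -- is 1, so that 1 serves as ε.
    partialSum≤κ a ha n = subst₂ (λ r s → ∣ r ∣ ≤ s) (ℚₚ.+-identityʳ (partialSum c n a)) (ℚₚ.*-identityʳ κ)
      (tail-ε {1ℚ} a ha 0 n ℕ.z≤n ℚₚ.≤-refl)

  module Uniform (θ : ℚ) (0<θ : 0ℚ < θ) (θ<1 : θ < 1ℚ) (X : ℚ) (0≤X : 0ℚ ≤ X) where

    0≤θ : 0ℚ ≤ θ
    0≤θ = ℚₚ.<⇒≤ 0<θ

    module Log = SeriesBound θ 0≤θ θ<1 logCoeff θ 1ℚ 0<θ 0≤1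
      (λ m → *-monoʳ (^-nonNeg 0≤θ m) (LogEstimate.∣logCoeff∣≤1 m))

    module Geo = SeriesBound θ 0≤θ θ<1 (λ _ → 1ℚ) θ 1ℚ 0<θ 0≤1 (λ _ → ℚₚ.≤-refl)

    -- Bounds y L(u) for |y| ≤ X and 0 ≤ u ≤ θ; the summand 1 makes it positive, as the exponential
    -- estimate requires.
    M : ℚ
    M = X * Log.κ + 1ℚ

    0<M : 0ℚ < M
    0<M = ℚₚ.+-mono-≤-< (*-nonNeg 0≤X Log.0≤κ) 0<1

    expBound : ∃ λ B → 0ℚ ≤ B × (∀ m → ∣ 1/! m ∣ * M ^ℚ m ≤ B * ½ ^ℚ m)
    expBound = exp-coeff-bound M 0<M

    B : ℚ
    B = proj₁ expBound

    module Exp = SeriesBound ½ 0≤½ ½<1 1/! M B 0<M (proj₁ (proj₂ expBound)) (proj₂ (proj₂ expBound))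

    -- The constant in front of 2^(-n) in the truncation error: `Geo.κ` bounds the damping factor,
    -- and in each of the two corrections X bounds the coefficient, B the last term up to 2^(-n),
    -- and `Exp.κ` the other exponential.
    K : ℚ
    K = Geo.κ * (X * B * Exp.κ + X * B * Exp.κ)

    0≤K : 0ℚ ≤ K
    0≤K = *-nonNeg Geo.0≤κ (+-nonNeg 0≤XBκ 0≤XBκ)
      where
      0≤XBκ : 0ℚ ≤ X * B * Exp.κ
      0≤XBκ = *-nonNeg (*-nonNeg 0≤X (proj₁ (proj₂ expBound))) Exp.0≤κ

    module _ (n : ℕ) (x : ℚ) (hx : ∣ x ∣ ≤ X) (h1-x : ∣ 1ℚ - x ∣ ≤ X) where

      defect-equation≤ : ∀ u → 0ℚ ≤ u → u ≤ θ →
        ∣ defect′ n x u + geometric n u * defect (suc n) x u ∣ ≤ θ ^ℚ n + K * ½ ^ℚ n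
      defect-equation≤ u 0≤u u≤θ = begin
        ∣ defect′ n x u + geometric n u * defect (suc n) x u ∣
          ≡⟨ cong ∣_∣ (defect-equation n x u) ⟩
        ∣ u ^ℚ n + geometric n u * (s x (1ℚ - x) + s (1ℚ - x) x) ∣
          ≤⟨ ∣p+q∣≤ {u ^ℚ n} {geometric n u * (s x (1ℚ - x) + s (1ℚ - x) x)} (∣^∣≤ ∣u∣≤θ n)
               (∣p*q∣≤ {geometric n u} {s x (1ℚ - x) + s (1ℚ - x) x} (Geo.partialSum≤κ u ∣u∣≤θ n)
                 (∣p+q∣≤ {s x (1ℚ - x)} {s (1ℚ - x) x} (s≤ hx h1-x) (s≤ h1-x hx))) ⟩
        θ ^ℚ n + Geo.κ * (X * (B * ½ ^ℚ n) * Exp.κ + X * (B * ½ ^ℚ n) * Exp.κ)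
          ≡⟨ cong (_+_ (θ ^ℚ n)) (solve 5 (λ g x b p k → g :* (x :* (b :* p) :* k :+ x :* (b :* p) :* k)
               := g :* (x :* b :* k :+ x :* b :* k) :* p) refl Geo.κ X B (½ ^ℚ n) Exp.κ) ⟩
        θ ^ℚ n + K * ½ ^ℚ n ∎
        where
        l : ℚ
        l = L (suc n) u

        s : ℚ → ℚ → ℚ
        s y z = y * term n (y * l) * E (suc n) (z * l)

        ∣u∣≤θ : ∣ u ∣ ≤ θ
        ∣u∣≤θ = subst (_≤ θ) (sym (ℚₚ.0≤p⇒∣p∣≡p 0≤u)) u≤θ

        yl≤M : ∀ {y} → ∣ y ∣ ≤ X → ∣ y * l ∣ ≤ M
        yl≤M {y} hy = ℚₚ.≤-trans (∣p*q∣≤ {y} {l} hy (Log.partialSum≤κ u ∣u∣≤θ (suc n))) (p≤p+q 0≤1)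

        s≤ : ∀ {y z} → ∣ y ∣ ≤ X → ∣ z ∣ ≤ X → ∣ s y z ∣ ≤ X * (B * ½ ^ℚ n) * Exp.κ
        s≤ {y} {z} hy hz = ∣p*q∣≤ {y * term n (y * l)} {E (suc n) (z * l)}
          (∣p*q∣≤ {y} {term n (y * l)} hy (Exp.term≤ (y * l) (yl≤M hy) n))
          (Exp.partialSum≤κ (z * l) (yl≤M hz) (suc n))

      defect≤ : ∀ u → 0ℚ ≤ u → u ≤ θ → ∣ defect (suc n) x u ∣ ≤ θ ^ℚ n + K * ½ ^ℚ n
      defect≤ u 0≤u u≤θ = begin
        ∣ defect (suc n) x u ∣                                 ≤⟨ growth ⟩
        ∣ defect (suc n) x 0ℚ ∣ + (θ ^ℚ n + K * ½ ^ℚ n)        ≡⟨ cong (λ r → ∣ r ∣ + (θ ^ℚ n + K * ½ ^ℚ n)) (defect-0 n x) ⟩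
        0ℚ + (θ ^ℚ n + K * ½ ^ℚ n)                             ≡⟨ ℚₚ.+-identityˡ (θ ^ℚ n + K * ½ ^ℚ n) ⟩
        θ ^ℚ n + K * ½ ^ℚ n                                    ∎
        where
        growth : ∣ defect (suc n) x u ∣ ≤ ∣ defect (suc n) x 0ℚ ∣ + (θ ^ℚ n + K * ½ ^ℚ n)
        growth = Damped.growth≤η (defect-derivative n x) (geometric n) {u} {Geo.κ}
          (0≤u , ℚₚ.≤-trans u≤θ (ℚₚ.<⇒≤ θ<1))
          (λ v 0≤v _ → geometric-nonNeg n 0≤v)
          (λ v 0≤v v≤u → subst (_≤ Geo.κ) (ℚₚ.0≤p⇒∣p∣≡p (geometric-nonNeg n 0≤v))
            (Geo.partialSum≤κ v (subst (_≤ θ) (sym (ℚₚ.0≤p⇒∣p∣≡p 0≤v)) (ℚₚ.≤-trans v≤u u≤θ)) n))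
          (λ v 0≤v v≤u → defect-equation≤ v 0≤v (ℚₚ.≤-trans v≤u u≤θ))

    -- The bound θ^n + K 2^(-n) does not involve x or u. This uniformity is what the diagonal limits
    -- defining `exp` and `log` demand, since there x and u vary with n.
    defect-vanishes : ∀ ε → 0ℚ < ε → ∃ λ N → ∀ n → N ℕ.≤ n → ∀ x u → ∣ x ∣ ≤ X → ∣ 1ℚ - x ∣ ≤ X →
      0ℚ ≤ u → u ≤ θ → ∣ defect n x u ∣ ≤ ε
    defect-vanishes ε 0<ε =
      let 0<1+K   = ℚₚ.+-mono-<-≤ 0<1 0≤K
          e       = ε * inv (1ℚ + K) 0<1+K
          0<e     = *-pos 0<ε (inv-pos (1ℚ + K) 0<1+K)
          N₁ , h₁ = Geometric.vanishes θ 0≤θ θ<1 e 0<e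
          N₂ , h₂ = Geometric.vanishes ½ 0≤½ ½<1 e 0<e
      -- The shift by one arises because truncations of length n + 1 are bounded by n-th powers.
      in suc (N₁ ℕ.⊔ N₂) , λ where
        (suc n) (ℕ.s≤s N≤n) x u hx h1-x 0≤u u≤θ → begin
          ∣ defect (suc n) x u ∣         ≤⟨ defect≤ n x hx h1-x u 0≤u u≤θ ⟩
          θ ^ℚ n + K * ½ ^ℚ n            ≤⟨ ℚₚ.+-mono-≤ (h₁ n (ℕₚ.m⊔n≤o⇒m≤o N₁ N₂ N≤n)) (*-monoˡ 0≤K (h₂ n (ℕₚ.m⊔n≤o⇒n≤o N₁ N₂ N≤n))) ⟩
          e + K * e                      ≡⟨ solve 3 (λ ε i k → ε :* i :+ k :* (ε :* i) := ε :* ((con 1ℚ :+ k) :* i)) refl ε (inv (1ℚ + K) 0<1+K) K ⟩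
          ε * ((1ℚ + K) * inv (1ℚ + K) 0<1+K) ≡⟨ cong (ε *_) (inv-inverseʳ (1ℚ + K) 0<1+K) ⟩
          ε * 1ℚ                         ≡⟨ ℚₚ.*-identityʳ ε ⟩
          ε                              ∎

-- Fractions with integer numerator.

module Fractions where

  open import Data.Rational.Base using (_+_; _*_; _-_; -_)
  open import Data.Integer.Solver using () renaming (module +-*-Solver to ℤ-Solver)
  open ℤ-Solver using (solve; _:+_; _:*_; _:=_; con)

  /-+ : ∀ i j → (i ℤ.+ j) ℚ./ 1 ≡ i ℚ./ 1 + j ℚ./ 1
  /-+ i j = ℚₚ.toℚᵘ-injective (ℚᵘₚ.≃-trans (toℚᵘ-/ (i ℤ.+ j) 0) (ℚᵘₚ.≃-sym
    (ℚᵘₚ.≃-trans (ℚₚ.toℚᵘ-homo-+ (i ℚ./ 1) (j ℚ./ 1))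
    (ℚᵘₚ.≃-trans (ℚᵘₚ.+-cong (toℚᵘ-/ i 0) (toℚᵘ-/ j 0))
    (ℚᵘ.*≡* (solve 2 (λ i j → (i :* con 1ℤ :+ j :* con 1ℤ) :* con 1ℤ := (i :+ j) :* con 1ℤ) refl i j))))))

  /-neg : ∀ i → (ℤ.- i) ℚ./ 1 ≡ - (i ℚ./ 1)
  /-neg i = ℚₚ.toℚᵘ-injective (ℚᵘₚ.≃-trans (toℚᵘ-/ (ℤ.- i) 0) (ℚᵘₚ.≃-sym
    (ℚᵘₚ.≃-trans (ℚₚ.toℚᵘ-homo‿- (i ℚ./ 1)) (ℚᵘₚ.-‿cong (toℚᵘ-/ i 0)))))

  /-split : ∀ i n → i ℚ./ suc n ≡ i ℚ./ 1 * (1ℤ ℚ./ suc n)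
  /-split i n = ℚₚ.toℚᵘ-injective (ℚᵘₚ.≃-trans (toℚᵘ-/ i n) (ℚᵘₚ.≃-sym
    (ℚᵘₚ.≃-trans (ℚₚ.toℚᵘ-homo-* (i ℚ./ 1) (1ℤ ℚ./ suc n))
    (ℚᵘₚ.≃-trans (ℚᵘₚ.*-cong (toℚᵘ-/ i 0) (toℚᵘ-/ 1ℤ n))
    (ℚᵘ.*≡* (trans (cong (ℤ._* + suc n) (ℤₚ.*-identityʳ i))
      (cong (λ k → i ℤ.* + suc k) (sym (ℕₚ.+-identityʳ n)))))))))

  [n-k]/n : ∀ n k → (+ suc n ℤ.- + k) ℚ./ suc n ≡ (fromℕ (suc n) - fromℕ k) * (1ℤ ℚ./ suc n)
  [n-k]/n n k = trans (/-split (+ suc n ℤ.- + k) n) (cong (_* (1ℤ ℚ./ suc n))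
    (trans (/-+ (+ suc n) (ℤ.- + k)) (cong (_+_ (fromℕ (suc n))) (/-neg (+ k)))))

open Fractions
open import Defs
open +-*-Solver using (solve; _:+_; _:*_; _:-_; :-_; _:=_; con)

-- Passing from rational identities to equality of reals.

-- A Cauchy sequence is bounded, so multiplying a null sequence by it leaves a null sequence. This
-- carries the law q^x q^(1-x) = q over to the final identity.
≃-by-multiple : ∀ {x y s t} z N → x ≃ y →
  (∀ n → N ℕ.≤ n → seq s n ℚ.- seq t n ≡ (seq x n ℚ.- seq y n) ℚ.* seq z n) → s ≃ t
≃-by-multiple {x} {y} {s} {t} z N x≃y multiple ε 0<ε =
  let C , 0≤C , hC = cauchy-bounded (seq z) (isCauchy z)
      0<C+1        = ℚₚ.+-mono-≤-< 0≤C 0<1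
      i            = inv (C ℚ.+ 1ℚ) 0<C+1
      e            = ε ℚ.* i
      0<e          = *-pos 0<ε (inv-pos (C ℚ.+ 1ℚ) 0<C+1)
      K , h        = x≃y e 0<e
  in N ℕ.⊔ K , λ n N≤n → begin
    ∣ seq s n ℚ.- seq t n ∣                       ≡⟨ cong ∣_∣ (multiple n (ℕₚ.m⊔n≤o⇒m≤o N K N≤n)) ⟩
    ∣ (seq x n ℚ.- seq y n) ℚ.* seq z n ∣         ≤⟨ Calculus.∣p*q∣≤ {seq x n ℚ.- seq y n} {seq z n} (h n (ℕₚ.m⊔n≤o⇒n≤o N K N≤n)) (hC n) ⟩
    e ℚ.* C                                       ≤⟨ *-monoˡ (ℚₚ.<⇒≤ 0<e) (p≤p+q {C} 0≤1) ⟩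
    e ℚ.* (C ℚ.+ 1ℚ)                              ≡⟨ ℚₚ.*-assoc ε i (C ℚ.+ 1ℚ) ⟩
    ε ℚ.* (i ℚ.* (C ℚ.+ 1ℚ))                      ≡⟨ cong (ε ℚ.*_) (inv-inverseˡ (C ℚ.+ 1ℚ) 0<C+1) ⟩
    ε ℚ.* 1ℚ                                      ≡⟨ ℚₚ.*-identityʳ ε ⟩
    ε                                             ∎
  where open ℚₚ.≤-Reasoning

-- The reciprocal inverts the maximum of δ and x_n, which agrees with x_n only from the index where
-- the witness δ becomes a lower bound.
reciprocal-inverse : ∀ x (0<x : 0ℝ < x) → ∃ λ N → ∀ n → N ℕ.≤ n → seq x n ℚ.* seq (reciprocal x 0<x) n ≡ 1ℚ
reciprocal-inverse x (δ , 0<δ , N , h) = N , λ n N≤n → trans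
  (cong (ℚ._* inv (δ ℚ.⊔ seq x n) (δ⊔p>0 0<δ (seq x n)))
    (sym (ℚₚ.p≤q⇒p⊔q≡q (subst (ℚ._≤ seq x n) (ℚₚ.+-identityˡ δ) (h n N≤n)))))
  (inv-inverseʳ (δ ℚ.⊔ seq x n) (δ⊔p>0 0<δ (seq x n)))

-- Recurrences for the coefficients of the generating function.

-- The coefficient form of t f′ = (k + β t) f for f = tᵏ e and e′ = β e.
shift-recurrence : ∀ (T : ℕ → ℕ → ℚ) (e : ℕ → ℚ) (β : ℚ) →
  (∀ n → T 0 n ≡ e n) → (∀ k → T (suc k) 0 ≡ 0ℚ) → (∀ k n → T (suc k) (suc n) ≡ T k n) →
  (∀ n → fromℕ (suc n) ℚ.* e (suc n) ≡ β ℚ.* e n) →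
  ∀ k n → (fromℕ (suc n) ℚ.- fromℕ k) ℚ.* T k (suc n) ≡ β ℚ.* T k n
shift-recurrence T e β T₀ T-zero T-suc e-suc = recurrence
  where
  p-0≡p : ∀ p → p ℚ.- fromℕ 0 ≡ p
  p-0≡p = ℚₚ.+-identityʳ

  suc-suc : ∀ n k → fromℕ (suc n) ℚ.- fromℕ (suc k) ≡ fromℕ n ℚ.- fromℕ k
  suc-suc n k = trans (cong₂ ℚ._-_ (fromℕ-suc n) (fromℕ-suc k))
    (solve 2 (λ a b → (con 1ℚ :+ a) :- (con 1ℚ :+ b) := a :- b) refl (fromℕ n) (fromℕ k))

  recurrence : ∀ k n → (fromℕ (suc n) ℚ.- fromℕ k) ℚ.* T k (suc n) ≡ β ℚ.* T k n
  -- This is `recurrence` with n lowered by one: `T (suc k) n` stands for the entry of `T k` at n -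
  -- 1, and is 0 when n = 0.
  shifted    : ∀ k n → (fromℕ n ℚ.- fromℕ k) ℚ.* T k n ≡ β ℚ.* T (suc k) n

  recurrence zero    n = trans (cong₂ ℚ._*_ (p-0≡p (fromℕ (suc n))) (T₀ (suc n)))
    (trans (e-suc n) (cong (β ℚ.*_) (sym (T₀ n))))
  recurrence (suc k) n = trans (cong₂ ℚ._*_ (suc-suc n k) (T-suc k n)) (shifted k n)

  -- At n = 0 the left side vanishes for two different reasons: the factor n - k when k = 0, the
  -- entry `T k 0` when k > 0.
  shifted zero    zero    = trans (ℚₚ.*-zeroˡ (T 0 0)) (sym (trans (cong (β ℚ.*_) (T-zero 0)) (ℚₚ.*-zeroʳ β)))
  shifted (suc k) zero    = trans
    (trans (cong ((fromℕ 0 ℚ.- fromℕ (suc k)) ℚ.*_) (T-zero k)) (ℚₚ.*-zeroʳ (fromℕ 0 ℚ.- fromℕ (suc k))))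
    (sym (trans (cong (β ℚ.*_) (T-zero (suc k))) (ℚₚ.*-zeroʳ β)))
  shifted k       (suc n) = trans (recurrence k n) (cong (β ℚ.*_) (sym (T-suc k n)))

-- `B k n x` unfolds to this with a = `[ x ]` and b = `[ 1ℝ - x ]`; the recurrence holds for
-- arbitrary a and b.
bernstein : ℝ → ℝ → ℕ → ℕ → ℝ
bernstein a b k n = fromℚ (fromℕ (n !)) * (t^ k ⊛ expSeries b ⊛ constant (a ^ k * fromℚ (1/! k))) n

-- The reals occurring in the coefficient identities agree term by term, so the
-- identities are proved at a fixed index m of the representing sequences.
module Coefficients (m : ℕ) where

  Σ≤-head : ∀ n f → seq (Σ≤ (suc n) f) m ≡ seq (f 0) m ℚ.+ seq (Σ≤ n (λ i → f (suc i))) m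
  Σ≤-head zero    f = refl
  Σ≤-head (suc n) f = trans (cong (ℚ._+ seq (f (suc (suc n))) m) (Σ≤-head n f))
    (ℚₚ.+-assoc (seq (f 0) m) (seq (Σ≤ n (λ i → f (suc i))) m) (seq (f (suc (suc n))) m))

  Σ≤-zero : ∀ n f → (∀ i → i ℕ.≤ n → seq (f i) m ≡ 0ℚ) → seq (Σ≤ n f) m ≡ 0ℚ
  Σ≤-zero zero    f h = h 0 ℕ.z≤n
  Σ≤-zero (suc n) f h = cong₂ ℚ._+_ (Σ≤-zero n f (λ i i≤n → h i (ℕₚ.m≤n⇒m≤1+n i≤n))) (h (suc n) ℕₚ.≤-refl)

  Σ≤-cong : ∀ n f g → (∀ i → seq (f i) m ≡ seq (g i) m) → seq (Σ≤ n f) m ≡ seq (Σ≤ n g) m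
  Σ≤-cong zero    f g h = h 0
  Σ≤-cong (suc n) f g h = cong₂ ℚ._+_ (Σ≤-cong n f g h) (h (suc n))

  t⁰⊛ : ∀ g n → seq ((t^ 0 ⊛ g) n) m ≡ seq (g n) m
  t⁰⊛ g zero    = ℚₚ.*-identityˡ (seq (g 0) m)
  t⁰⊛ g (suc n) = trans (Σ≤-head n (λ i → (t^ 0) i * g (suc n ∸ i))) (trans
    (cong₂ ℚ._+_ (ℚₚ.*-identityˡ (seq (g (suc n)) m))
      (Σ≤-zero n (λ i → (t^ 0) (suc i) * g (suc n ∸ suc i)) (λ i _ → ℚₚ.*-zeroˡ (seq (g (n ∸ i)) m))))
    (ℚₚ.+-identityʳ (seq (g (suc n)) m)))

  t^suc⊛-zero : ∀ k g → seq ((t^ suc k ⊛ g) 0) m ≡ 0ℚ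
  t^suc⊛-zero k g = ℚₚ.*-zeroˡ (seq (g 0) m)

  t^suc⊛-suc : ∀ k g n → seq ((t^ suc k ⊛ g) (suc n)) m ≡ seq ((t^ k ⊛ g) n) m
  t^suc⊛-suc k g n = trans (Σ≤-head n (λ i → (t^ suc k) i * g (suc n ∸ i))) (trans
    (cong₂ ℚ._+_ (ℚₚ.*-zeroˡ (seq (g (suc n)) m))
      (Σ≤-cong n (λ i → (t^ suc k) (suc i) * g (suc n ∸ suc i)) (λ i → (t^ k) i * g (n ∸ i)) (λ _ → refl)))
    (ℚₚ.+-identityˡ (seq ((t^ k ⊛ g) n) m)))

  ⊛-constant : ∀ f a n → seq ((f ⊛ constant a) n) m ≡ seq (f n) m ℚ.* seq a m
  ⊛-constant f a zero    = refl
  ⊛-constant f a (suc n) = trans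
    (cong₂ ℚ._+_
      (Σ≤-zero n (λ i → f i * constant a (suc n ∸ i)) λ i i≤n → trans
        -- For i ≤ n the second index is rewritten as a successor, so that `constant` reduces to 0
        -- and only the last summand survives.
        (cong (λ j → seq (f i * constant a j) m) (ℕₚ.+-∸-assoc 1 i≤n))
        (ℚₚ.*-zeroʳ (seq (f i) m)))
      (cong (λ j → seq (f (suc n) * constant a j) m) (ℕₚ.n∸n≡0 n)))
    (ℚₚ.+-identityˡ (seq (f (suc n)) m ℚ.* seq a m))

  t^⊛exp-recurrence : ∀ b k n → (fromℕ (suc n) ℚ.- fromℕ k) ℚ.* seq ((t^ k ⊛ expSeries b) (suc n)) m
                              ≡ seq b m ℚ.* seq ((t^ k ⊛ expSeries b) n) m
  t^⊛exp-recurrence b = shift-recurrence (λ k n → seq ((t^ k ⊛ expSeries b) n) m)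
    (λ n → seq (expSeries b n) m) (seq b m)
    (t⁰⊛ (expSeries b)) (λ k → t^suc⊛-zero k (expSeries b)) (λ k → t^suc⊛-suc k (expSeries b))
    (λ n → exp-step (fromℕ (suc n)) (seq b m) (seq (b ^ n) m) (1/!-suc n))
    where
    exp-step : ∀ k b p {c c′} → k ℚ.* c′ ≡ c → k ℚ.* (b ℚ.* p ℚ.* c′) ≡ b ℚ.* (p ℚ.* c)
    exp-step k b p {c} {c′} h = trans
      (solve 4 (λ k b p c → k :* (b :* p :* c) := b :* (p :* (k :* c))) refl k b p c′)
      (cong (λ r → b ℚ.* (p ℚ.* r)) h)

  bernstein≡ : ∀ a b k n → seq (bernstein a b k n) m
             ≡ fromℕ (n !) ℚ.* (seq ((t^ k ⊛ expSeries b) n) m ℚ.* (seq (a ^ k) m ℚ.* 1/! k))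
  bernstein≡ a b k n = cong (fromℕ (n !) ℚ.*_) (⊛-constant (t^ k ⊛ expSeries b) (a ^ k * fromℚ (1/! k)) n)

  -- The first summand reduces by the recurrence for t^k exp(b t), the second by the shift in k
  -- together with (k+1) / (k+1)! = 1 / k!. In both, (n+1)! = (n+1) n! supplies the factor that
  -- cancels the denominator n + 1.
  bernstein-recurrence : ∀ a b k n →
    ((+ suc n ℤ.- + k) ℚ./ suc n) ℚ.* seq (bernstein a b k (suc n)) m
      ℚ.+ (+ suc k ℚ./ suc n) ℚ.* seq (bernstein a b (suc k) (suc n)) m
      ≡ (seq a m ℚ.+ seq b m) ℚ.* seq (bernstein a b k n) m
  bernstein-recurrence a b k n = combine
    {F = fromℕ (n !)} {N = fromℕ (suc n)} {k = fromℕ k} {k₁ = fromℕ (suc k)} {i = 1ℤ ℚ./ suc n} {c = 1/! k} {c₁ = 1/! (suc k)}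
    {T = seq ((t^ k ⊛ expSeries b) n) m} {p = seq (a ^ k) m} {α = seq a m} {β = seq b m}
    (bernstein≡ a b k (suc n)) (bernstein≡ a b (suc k) (suc n)) (bernstein≡ a b k n)
    ([n-k]/n n k) (/-split (+ suc k) n) (fromℕ-* (suc n) (n !)) (n*1/n≡1 (suc n)) (1/!-suc k)
    (t^⊛exp-recurrence b k n) (t^suc⊛-suc k (expSeries b) n)
    where
    -- With all terms abstracted to rational variables, the claim is a ring identity modulo the
    -- listed equations.
    combine : ∀ {B₁ B₂ B₀ f₁ f₂ F₁ F N k k₁ i c c₁ T₁ T₂ T p α β} →
      B₁ ≡ F₁ ℚ.* (T₁ ℚ.* (p ℚ.* c)) → B₂ ≡ F₁ ℚ.* (T₂ ℚ.* (α ℚ.* p ℚ.* c₁)) → B₀ ≡ F ℚ.* (T ℚ.* (p ℚ.* c)) →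
      f₁ ≡ (N ℚ.- k) ℚ.* i → f₂ ≡ k₁ ℚ.* i → F₁ ≡ N ℚ.* F → N ℚ.* i ≡ 1ℚ → k₁ ℚ.* c₁ ≡ c →
      (N ℚ.- k) ℚ.* T₁ ≡ β ℚ.* T → T₂ ≡ T →
      f₁ ℚ.* B₁ ℚ.+ f₂ ℚ.* B₂ ≡ (α ℚ.+ β) ℚ.* B₀
    combine {F = F} {N} {k} {k₁} {i} {c} {c₁} {T₁} {T₂} {T} {p} {α} {β} refl refl refl refl refl refl Ni≡1 k₁c₁≡c [N-k]T₁≡βT refl = begin
      ((N ℚ.- k) ℚ.* i) ℚ.* ((N ℚ.* F) ℚ.* (T₁ ℚ.* (p ℚ.* c))) ℚ.+ (k₁ ℚ.* i) ℚ.* ((N ℚ.* F) ℚ.* (T ℚ.* (α ℚ.* p ℚ.* c₁)))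
        ≡⟨ solve 11 (λ N k i F T₁ p c k₁ T α c₁ →
             ((N :- k) :* i) :* ((N :* F) :* (T₁ :* (p :* c))) :+ (k₁ :* i) :* ((N :* F) :* (T :* (α :* p :* c₁)))
             := (N :* i) :* F :* p :* (((N :- k) :* T₁) :* c :+ T :* α :* (k₁ :* c₁)))
             refl N k i F T₁ p c k₁ T α c₁ ⟩
      (N ℚ.* i) ℚ.* F ℚ.* p ℚ.* (((N ℚ.- k) ℚ.* T₁) ℚ.* c ℚ.+ T ℚ.* α ℚ.* (k₁ ℚ.* c₁))
        ≡⟨ cong₂ (λ u v → u ℚ.* F ℚ.* p ℚ.* v) Ni≡1
             (cong₂ (λ u v → u ℚ.* c ℚ.+ T ℚ.* α ℚ.* v) [N-k]T₁≡βT k₁c₁≡c) ⟩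
      1ℚ ℚ.* F ℚ.* p ℚ.* ((β ℚ.* T) ℚ.* c ℚ.+ T ℚ.* α ℚ.* c)
        ≡⟨ solve 6 (λ F p β T c α → con 1ℚ :* F :* p :* ((β :* T) :* c :+ T :* α :* c) := (α :+ β) :* (F :* (T :* (p :* c))))
             refl F p β T c α ⟩
      (α ℚ.+ β) ℚ.* (F ℚ.* (T ℚ.* (p ℚ.* c))) ∎
      where open ≡-Reasoning

-- The law q^x q^(1-x) = q and the final identity.

-- With a = [x] and b = [1 - x], the quantity a + b - 1 - (1 - q) a b is
-- (q - q^x q^(1-x)) / (1 - q), up to a multiple of 1 - (1 - q) / (1 - q).
bracket-defect : ∀ A A′ r q w → (1ℚ ℚ.- q) ℚ.* r ≡ 1ℚ →
  let a = (1ℚ ℚ.- A) ℚ.* r ; b = (1ℚ ℚ.- A′) ℚ.* r in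
  (a ℚ.+ b) ℚ.* w ℚ.- (w ℚ.+ (1ℚ ℚ.- q) ℚ.* a ℚ.* b ℚ.* w) ≡ (A ℚ.* A′ ℚ.- q) ℚ.* (ℚ.- (r ℚ.* w))
bracket-defect A A′ r q w pr≡1 = trans
  (solve 5 (λ A A′ r q w →
    ((con 1ℚ :- A) :* r :+ (con 1ℚ :- A′) :* r) :* w
      :- (w :+ (con 1ℚ :- q) :* ((con 1ℚ :- A) :* r) :* ((con 1ℚ :- A′) :* r) :* w)
    := (A :* A′ :- q) :* (:- (r :* w))
       :+ (con 1ℚ :- (con 1ℚ :- q) :* r) :* (((con 1ℚ :- A) :* (con 1ℚ :- A′) :* r :- con 1ℚ) :* w))
    refl A A′ r q w)
  (trans (cong (λ s → (A ℚ.* A′ ℚ.- q) ℚ.* (ℚ.- (r ℚ.* w)) ℚ.+ (1ℚ ℚ.- s) ℚ.* z) pr≡1)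
    (solve 2 (λ u z → u :+ con 0ℚ :* z := u) refl ((A ℚ.* A′ ℚ.- q) ℚ.* (ℚ.- (r ℚ.* w))) z))
  where
  z : ℚ
  z = ((1ℚ ℚ.- A) ℚ.* (1ℚ ℚ.- A′) ℚ.* r ℚ.- 1ℚ) ℚ.* w

module _ (q : ℝ) (0<q : 0ℝ < q) (q<1 : q < 1ℝ) where

  open QBernstein q 0<q q<1

  q^x*q^[1-x]≃q : ∀ x → q^ x * q^ (1ℝ - x) ≃ q
  q^x*q^[1-x]≃q x ε 0<ε =
    let δ , 0<δ , N , δ≤q     = 0<q
        δ′ , 0<δ′ , N′ , q≤1-δ′ = q<1
        X , 0≤X , hX          = cauchy-bounded (seq x) (isCauchy x)
        -- Eventually u = 1 - q_n lies in [δ′, θ]: the witness of 0 < q keeps it away from 1, and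
        -- that of q < 1 keeps it positive, which also forces 0 < θ.
        θ                     = 1ℚ ℚ.- δ
        lower : ∀ n → N′ ℕ.≤ n → δ′ ℚ.≤ 1ℚ ℚ.- seq q n
        lower n N′≤n          = p+r≤q⇒r≤q-p {seq q n} (q≤1-δ′ n N′≤n)
        upper : ∀ n → N ℕ.≤ n → 1ℚ ℚ.- seq q n ℚ.≤ θ
        upper n N≤n           = ℚₚ.+-monoʳ-≤ 1ℚ (ℚₚ.neg-antimono-≤
          (subst (ℚ._≤ seq q n) (ℚₚ.+-identityˡ δ) (δ≤q n N≤n)))
        0<θ                   = ℚₚ.<-≤-trans 0<δ′ (ℚₚ.≤-trans
          (lower (N ℕ.⊔ N′) (ℕₚ.m≤n⊔m N N′)) (upper (N ℕ.⊔ N′) (ℕₚ.m≤m⊔n N N′)))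
        θ<1                   = subst (θ ℚ.<_) (ℚₚ.+-identityʳ 1ℚ) (ℚₚ.+-monoʳ-< 1ℚ (ℚₚ.neg-antimono-< 0<δ))
        -- The constant 1 + X bounds both |x_n| and |1 - x_n|.
        K , h                 = ExpLog.Uniform.defect-vanishes θ 0<θ θ<1 (1ℚ ℚ.+ X) (+-nonNeg 0≤1 0≤X) ε 0<ε
    in K ℕ.⊔ (N ℕ.⊔ N′) , λ n K≤n →
      let N⊔N′≤n = ℕₚ.m⊔n≤o⇒n≤o K (N ℕ.⊔ N′) K≤n
      -- By the definitions of `exp` and `log`, the n-th term of q^x q^(1-x) is the product
      -- occurring in `defect n` at x_n and u = 1 - q_n; the remaining summand u - 1 is - q_n.
      in subst (λ r → ∣ r ∣ ℚ.≤ ε)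
        (solve 2 (λ p q → p :+ ((con 1ℚ :- q) :+ con (ℚ.- 1ℚ)) := p :- q) refl
          (seq (q^ x * q^ (1ℝ - x)) n) (seq q n))
        (h n (ℕₚ.m⊔n≤o⇒m≤o K (N ℕ.⊔ N′) K≤n) (seq x n) (1ℚ ℚ.- seq q n)
          (ℚₚ.≤-trans (hX n) (p≤q+p 0≤1))
          (Calculus.∣p+q∣≤ {1ℚ} {ℚ.- seq x n} ℚₚ.≤-refl (subst (ℚ._≤ X) (sym (ℚₚ.∣-p∣≡∣p∣ (seq x n))) (hX n)))
          (ℚₚ.≤-trans (ℚₚ.<⇒≤ 0<δ′) (lower n (ℕₚ.m⊔n≤o⇒n≤o N N′ N⊔N′≤n)))
          (upper n (ℕₚ.m⊔n≤o⇒m≤o N N′ N⊔N′≤n)))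

theorem4 : (q : ℝ) (0<q : 0ℝ < q) (q<1 : q < 1ℝ) (k n : ℕ) .{{_ : NonZero n}} (x : ℝ) → 0ℝ ≤ x → x ≤ 1ℝ →
    let open QBernstein q 0<q q<1 in
    fromℚ ((+ n ℤ.- + k) ℚ./ n) * B k n x + fromℚ (+ suc k ℚ./ n) * B (suc k) n x
    ≃ B k (pred n) x + (1ℝ - q) * [ x ] * [ 1ℝ - x ] * B k (pred n) x
theorem4 q 0<q q<1 k (suc n) x _ _ =
  let a           = QBernstein.[_] q 0<q q<1 x
      b           = QBernstein.[_] q 0<q q<1 (1ℝ - x)
      0<1-q       = QBernstein.0<1-q q 0<q q<1
      qˣ          = QBernstein.q^_ q 0<q q<1 x
      q¹⁻ˣ        = QBernstein.q^_ q 0<q q<1 (1ℝ - x)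
      r           = reciprocal (1ℝ - q) 0<1-q
      w           = bernstein a b k n
      N , inverse = reciprocal-inverse (1ℝ - q) 0<1-q
  in ≃-by-multiple {qˣ * q¹⁻ˣ} {q}
       {fromℚ ((+ suc n ℤ.- + k) ℚ./ suc n) * bernstein a b k (suc n) + fromℚ (+ suc k ℚ./ suc n) * bernstein a b (suc k) (suc n)}
       {w + (1ℝ - q) * a * b * w}
       -- After the recurrence the two sides differ by (a + b) w - (w + (1 - q) a b w), which is q^x
       -- q^(1-x) - q times - w / (1 - q). From the index N on, r is a true inverse of 1 - q.
       (- (r * w)) N (q^x*q^[1-x]≃q q 0<q q<1 x) λ m N≤m → trans
         (cong (ℚ._- seq (w + (1ℝ - q) * a * b * w) m) (Coefficients.bernstein-recurrence m a b k n))
         (bracket-defect (seq qˣ m) (seq q¹⁻ˣ m) (seq r m) (seq q m) (seq w m) (inverse m N≤m))
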